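{- Let $P\subset\mathbb{R}^3$ be a convex lattice polytope of lattice width one enclosed between the planes $x=0$ and $x=1$. Denote $P_0=P\cap\{x=0\}$ and $P_1=P\cap\{x=1\}$, and consider $P_0$ and $P_1$ as subsets of the $(y,z)$-plane $\mathbb{R}^2$ by ignoring the $x$-coordinate. Suppose that, up to a lattice translation, $P_1$ is contained in the convex hull of the interior lattice points of $P_0$. Then $\operatorname{ls}_\Delta(P)=\operatorname{ls}_{\Delta_2}(P_0)$, and there exists a basis of $\mathbb{Z}^3$ that is reduced with respect to $P$ and computes $\operatorname{ls}_\Delta(P)$.
   Context: A lattice polytope in $\mathbb{R}^d$ is a convex polytope all of whose vertices lie in $\mathbb{Z}^d$. $\mathrm{AGL}(d,\mathbb{Z})$ is the group of affine unimodular maps $T(x)=Ax+h$ with $A\in\mathrm{GL}(d,\mathbb{Z})$ and $h\in\mathbb{Z}^d$. For a matrix $A$, $AP=\{Ax: x\in P\}$. Lattice size: for a lattice polytope $P\subset\mathbb{R}^d$ and the standard simplex $\operatorname{conv}\{0,e_1,\dots,e_d\}\subset\mathbb{R}^d$, the lattice size is the smallest $l\ge 0$ such that $T(P)$ is contained in the $l$-dilate of the standard simplex for some $T\in\mathrm{AGL}(d,\mathbb{Z})$. It is denoted $\operatorname{ls}_\Delta(P)$ for $d=3$ ($\Delta\subset\mathbb{R}^3$ the standard simplex) and $\operatorname{ls}_{\Delta_2}$ for $d=2$ ($\Delta_2\subset\mathbb{R}^2$ the standard $2$-simplex). Naive lattice size: $\operatorname{nls}_\Delta(P)$ is the smallest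 $l$ such that $T(P)\subset l\Delta$ for some $T$ that is a composition of multiplication by a diagonal matrix with entries $\pm1$ on the diagonal and a lattice translation. A basis $(h_1,h_2,h_3)$ of $\mathbb{Z}^3$ computes $\operatorname{ls}_\Delta(P)$ if $\operatorname{ls}_\Delta(P)=\operatorname{nls}_\Delta(AP)$, where $A$ is the matrix with rows $h_1,h_2,h_3$. For $h\in\mathbb{R}^d$, $\operatorname{w}_h(P)=\max_{x\in P}\langle h,x\rangle-\min_{x\in P}\langle h,x\rangle$, and the lattice width of $P$ is the minimum of $\operatorname{w}_h(P)$ over nonzero primitive $h\in\mathbb{Z}^d$. Write $\Vert h\Vert=\operatorname{w}_h(P)$. A basis $(h_1,h_2,h_3)$ of $\mathbb{Z}^3$ is reduced with respect to $P\subset\mathbb{R}^3$ if (1) $\Vert h_1\Vert\le\Vert h_2\Vert\le\Vert h_3\Vert$; (2) $\Vert h_1\pm h_2\Vert\ge\Vert h_2\Vert$ (both signs); (3) $\Vert mh_1+nh_2+h_3\Vert\ge\Vert h_3\Vert$ for all $m,n\in\mathbb{Z}$. -}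

module Defs where

open import Algebra.Bundles using (CommutativeRing)
import Algebra.Definitions.RawMonoid as RawMonoid
open import Data.Bool.Base using (if_then_else_)
open import Data.Fin.Base using (Fin)
open import Data.Fin.Patterns using (0F; 1F; 2F)
open import Data.Fin.Properties using (_≟_)
open import Data.Integer.Base as ℤ using (ℤ; +_; -[1+_]; 0ℤ; 1ℤ; ∣_∣; _◃_)
open import Data.Integer.Divisibility using (_∣_)
import Data.Nat.Base as ℕ
open import Data.Product using (_×_; _,_; Σ; ∃; ∃₂; ∃-syntax)
open import Data.Sign.Base using (Sign)
open import Data.Sum.Base using (_⊎_)
open import Data.Vec.Functional using (Vector; _∷_)
open import Level using (Level; _⊔_) renaming (suc to lsuc)
open import Relation.Binary.Core using (Rel)
open import Relation.Binary.PropositionalEquality using (_≡_)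
open import Relation.Binary.Structures using (IsTotalOrder)
open import Relation.Nullary using (¬_; does)
open import Relation.Unary using (Pred; _∈_; _⊆_; _≐_)

------------------------------------------------------------------------
-- Ordered fields

-- The standard library has no real numbers; the ambient space ℝ^d is
-- replaced by K^d for an arbitrary (linearly) ordered field K, the
-- classical ℝ being one such field.

record OrderedField c ℓ₁ ℓ₂ : Set (lsuc (c ⊔ ℓ₁ ⊔ ℓ₂)) where
  infix 4 _≤_ _<_
  field
    commutativeRing : CommutativeRing c ℓ₁
  open CommutativeRing commutativeRing public
  field
    1≉0          : ¬ (1# ≈ 0#)
    inverse      : ∀ x → ¬ (x ≈ 0#) → ∃[ y ] x * y ≈ 1#
    _≤_          : Rel Carrier ℓ₂
    isTotalOrder : IsTotalOrder _≈_ _≤_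
    +-monoʳ-≤    : ∀ x {y z} → y ≤ z → x + y ≤ x + z
    *-nonneg     : ∀ {x y} → 0# ≤ x → 0# ≤ y → 0# ≤ x * y

  _<_ : Rel Carrier (ℓ₁ ⊔ ℓ₂)
  x < y = x ≤ y × ¬ (x ≈ y)

------------------------------------------------------------------------
-- The lattice ℤ^d

Matrix : ℕ.ℕ → Set
Matrix d = Vector (Vector ℤ d) d

∑ℤ : ∀ {n} → Vector ℤ n → ℤ
∑ℤ = RawMonoid.sum ℤ.+-0-rawMonoid

infixl 6 _⊕_ _⊖_
infixr 7 _⊙_

_⊕_ _⊖_ : ∀ {d} → Vector ℤ d → Vector ℤ d → Vector ℤ d
(u ⊕ v) i = u i ℤ.+ v i
(u ⊖ v) i = u i ℤ.- v i

_⊙_ : ∀ {d} → ℤ → Vector ℤ d → Vector ℤ d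
(m ⊙ v) i = m ℤ.* v i

diagonal : ∀ {d} → Vector ℤ d → Matrix d
diagonal s i j = if does (i ≟ j) then s i else 0ℤ

identity : ∀ {d} → Matrix d
identity = diagonal (λ _ → 1ℤ)

_·_ : ∀ {d} → Matrix d → Matrix d → Matrix d
(A · B) i j = ∑ℤ (λ k → A i k ℤ.* B k j)

Invertible : ∀ {d} → Matrix d → Set
Invertible {d} A = Σ (Matrix d) λ B →
  (∀ i j → (A · B) i j ≡ identity i j) × (∀ i j → (B · A) i j ≡ identity i j)

SignDiagonal : ∀ {d} → Matrix d → Set
SignDiagonal {d} A = Σ (Vector Sign d) λ σ →
  ∀ i j → A i j ≡ diagonal (λ k → σ k ◃ 1) i j

combination : ∀ {n d} → Vector ℤ n → Vector (Vector ℤ d) n → Vector ℤ d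
combination c h j = ∑ℤ (λ i → c i ℤ.* h i j)

-- The rows of h form a ℤ-basis of ℤ^d.
IsBasis : ∀ {d} → Matrix d → Set
IsBasis {d} h =
  (∀ (z : Vector ℤ d) → Σ (Vector ℤ d) λ c → ∀ j → combination c h j ≡ z j) ×
  (∀ (c : Vector ℤ d) → (∀ j → combination c h j ≡ 0ℤ) → ∀ i → c i ≡ 0ℤ)

-- The zero vector is not primitive, since 2 divides all its entries.
Primitive : ∀ {d} → Vector ℤ d → Set
Primitive h = ∀ k → (∀ i → k ∣ h i) → ∣ k ∣ ≡ 1

------------------------------------------------------------------------
-- Convex geometry in K^d

module Geometry {c ℓ₁ ℓ₂} (K : OrderedField c ℓ₁ ℓ₂) where
  open OrderedField K
  open RawMonoid +-rawMonoid using (sum) renaming (_×_ to _times_)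

  Point : ℕ.ℕ → Set c
  Point d = Vector Carrier d

  infix 4 _≋_
  _≋_ : ∀ {d} → Rel (Point d) ℓ₁
  x ≋ y = ∀ i → x i ≈ y i

  ι : ℤ → Carrier
  ι (+ n)    = n times 1#
  ι -[1+ n ] = - (ℕ.suc n times 1#)

  lattice : ∀ {d} → Vector ℤ d → Point d
  lattice z i = ι (z i)

  ⟨_,_⟩ : ∀ {d} → Vector ℤ d → Point d → Carrier
  ⟨ h , x ⟩ = sum (λ i → ι (h i) * x i)

  IsLeast : ∀ {s} → Pred Carrier s → Pred Carrier (c ⊔ ℓ₂ ⊔ s)
  IsLeast S m = m ∈ S × (∀ x → x ∈ S → m ≤ x)

  IsGreatest : ∀ {s} → Pred Carrier s → Pred Carrier (c ⊔ ℓ₂ ⊔ s)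
  IsGreatest S m = m ∈ S × (∀ x → x ∈ S → x ≤ m)

  conv : ∀ {d s} → Pred (Point d) s → Pred (Point d) (c ⊔ ℓ₁ ⊔ ℓ₂ ⊔ s)
  conv {d} S x =
    ∃[ n ] Σ (Vector Carrier n) λ a → Σ (Vector (Point d) n) λ v →
      (∀ i → v i ∈ S) ×
      (∀ i → 0# ≤ a i) ×
      sum a ≈ 1# ×
      (∀ j → sum (λ i → a i * v i j) ≈ x j)

  -- The topological interior, with neighbourhoods given by closed cubes of
  -- side 2ε.
  interior : ∀ {d s} → Pred (Point d) s → Pred (Point d) (c ⊔ ℓ₁ ⊔ ℓ₂ ⊔ s)
  interior Q x = ∃[ ε ] 0# < ε ×
    (∀ y → (∀ i → x i - ε ≤ y i × y i ≤ x i + ε) → y ∈ Q)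

  interiorLatticePoints : ∀ {d s} →
    Pred (Point d) s → Pred (Point d) (c ⊔ ℓ₁ ⊔ ℓ₂ ⊔ s)
  interiorLatticePoints {d} Q x =
    (Σ (Vector ℤ d) λ z → x ≋ lattice z) × x ∈ interior Q

  IsLatticePolytope : ∀ {d s} → Pred (Point d) s → Set (c ⊔ ℓ₁ ⊔ ℓ₂ ⊔ s)
  IsLatticePolytope {d} P =
    ∃[ n ] Σ (Vector (Vector ℤ d) n) λ v →
      P ≐ conv (λ x → ∃[ i ] x ≋ lattice (v i))

  image : ∀ {d e s} → (Point d → Point e) →
          Pred (Point d) s → Pred (Point e) (c ⊔ ℓ₁ ⊔ s)
  image f S y = ∃[ x ] x ∈ S × y ≋ f x

  linear : ∀ {d} → Matrix d → Point d → Point d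
  linear A x i = ⟨ A i , x ⟩

  translate : ∀ {d} → Vector ℤ d → Point d → Point d
  translate t x i = x i + ι (t i)

  affine : ∀ {d} → Matrix d → Vector ℤ d → Point d → Point d
  affine A t x = translate t (linear A x)

  dilate : ∀ {d s} → Carrier → Pred (Point d) s → Pred (Point d) (c ⊔ ℓ₁ ⊔ s)
  dilate l = image (λ x i → l * x i)

  Δ : ∀ {d} → Pred (Point d) (c ⊔ ℓ₁ ⊔ ℓ₂)
  Δ {d} = conv (λ x → (∀ i → x i ≈ 0#) ⊎ (∃[ j ] x ≋ lattice (identity j)))

  -- l ≥ 0 is such that T(P) ⊆ lΔ for some T(x) = Ax + t with A in the class G
  -- and t ∈ ℤ^d.
  Fits : ∀ {d s} → (Matrix d → Set) → Pred (Point d) s →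
         Pred Carrier (c ⊔ ℓ₁ ⊔ ℓ₂ ⊔ s)
  Fits {d} G P l =
    0# ≤ l ×
    (Σ (Matrix d) λ A → Σ (Vector ℤ d) λ t →
      G A × image (affine A t) P ⊆ dilate l Δ)

  IsLatticeSize : ∀ {d s} → Pred (Point d) s →
                  Pred Carrier (c ⊔ ℓ₁ ⊔ ℓ₂ ⊔ s)
  IsLatticeSize P = IsLeast (Fits Invertible P)

  IsNaiveLatticeSize : ∀ {d s} → Pred (Point d) s →
                       Pred Carrier (c ⊔ ℓ₁ ⊔ ℓ₂ ⊔ s)
  IsNaiveLatticeSize P = IsLeast (Fits SignDiagonal P)

  values : ∀ {d s} → Vector ℤ d → Pred (Point d) s → Pred Carrier (c ⊔ ℓ₁ ⊔ s)
  values h P r = ∃[ x ] x ∈ P × r ≈ ⟨ h , x ⟩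

  IsWidth : ∀ {d s} → Pred (Point d) s → Vector ℤ d →
            Pred Carrier (c ⊔ ℓ₁ ⊔ ℓ₂ ⊔ s)
  IsWidth P h w = ∃₂ λ M m →
    IsGreatest (values h P) M × IsLeast (values h P) m × w ≈ M - m

  IsLatticeWidth : ∀ {d s} → Pred (Point d) s →
                   Pred Carrier (c ⊔ ℓ₁ ⊔ ℓ₂ ⊔ s)
  IsLatticeWidth {d} P =
    IsLeast (λ w → Σ (Vector ℤ d) λ h → Primitive h × IsWidth P h w)

  WidthLE : ∀ {d s} → Pred (Point d) s → Vector ℤ d → Vector ℤ d →
            Set (c ⊔ ℓ₁ ⊔ ℓ₂ ⊔ s)
  WidthLE P g h = ∃₂ λ w w′ → IsWidth P g w × IsWidth P h w′ × w ≤ w′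

  record IsReduced {s} (P : Pred (Point 3) s) (h : Matrix 3)
         : Set (c ⊔ ℓ₁ ⊔ ℓ₂ ⊔ s) where
    h₁ = h 0F
    h₂ = h 1F
    h₃ = h 2F
    field
      basis    : IsBasis h
      h₁≤h₂    : WidthLE P h₁ h₂
      h₂≤h₃    : WidthLE P h₂ h₃
      h₂≤h₁+h₂ : WidthLE P h₂ (h₁ ⊕ h₂)
      h₂≤h₁-h₂ : WidthLE P h₂ (h₁ ⊖ h₂)
      h₃-least : ∀ m n → WidthLE P h₃ (m ⊙ h₁ ⊕ n ⊙ h₂ ⊕ h₃)

  -- The matrix with rows h₁, h₂, h₃ is h itself.
  ComputesLatticeSize : ∀ {s} → Pred (Point 3) s → Matrix 3 →
                        Set (c ⊔ ℓ₁ ⊔ ℓ₂ ⊔ s)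
  ComputesLatticeSize P h =
    ∃[ l ] IsLatticeSize P l × IsNaiveLatticeSize (image (linear h) P) l

  -- P ∩ {x = a}, regarded as a subset of the (y,z)-plane.
  slice : ∀ {d s} → Carrier → Pred (Point (ℕ.suc d)) s → Pred (Point d) s
  slice a P y = (a ∷ y) ∈ P

{-# OPTIONS --safe #-}

-- Let H be the support function of P₀. A sum-zero triple of normals a, b, c spanning
-- a basis of ℤ² fits P₀ into a simplex of size M = H a + H b + H c, so the lattice
-- size of P₀ is the minimum of M over such triples. M is a mixed volume with the
-- triangle with these normals, hence monotone: any lattice triangle can be shrunk to
-- a unimodular one, and the four normals that place P₀ ⊆ P in a dilate of Δ₃ can be
-- merged to a triple. This gives ls P ≥ ls P₀.
--
-- Conversely a shear along x moves P₁ into the hull of the interior lattice points of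
-- P₀, where every nonzero a is at most H a - 1. The unit of slack absorbs the
-- coordinate x, so the lifted triple together with e₁ fits P. Minimality of M against
-- the triple (a, -b, b - a) forces w (a - b) ≥ w b, so a minimal triple sorted by
-- width is reduced, and its lift inherits this because widths of P dominate those of
-- P₀.
module Submission where

open import Defs
open import Algebra.Bundles using (CommutativeSemiring)
import Algebra.Properties.Monoid.Mult
import Algebra.Properties.Ring
import Algebra.Properties.Semiring.Sum
open import Data.Bool.Base using (true; false; if_then_else_)
open import Data.Empty using (⊥; ⊥-elim)
open import Data.Fin.Base as Fin using (Fin; zero; suc)
open import Data.Fin.Patterns using (0F; 1F; 2F)
import Data.Fin.Properties as Fin
open import Data.Integer.Base as ℤ using (ℤ; +_; -[1+_]; +[1+_]; +0; 0ℤ; 1ℤ; -1ℤ; ∣_∣; +≤+; -≤+; +<+)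
import Data.Integer.Properties as ℤ
open import Data.Integer.Tactic.RingSolver using (solve-∀)
import Data.Nat.Base as ℕ
import Data.Nat.Divisibility as ℕ
import Data.Nat.Properties as ℕ
open import Data.Product using (Σ; ∃; ∃-syntax; _×_; _,_; proj₁; proj₂)
import Data.Sign.Base as Sign
open import Data.Sum.Base as Sum using (_⊎_; inj₁; inj₂; [_,_]′)
open import Data.Unit.Base using (⊤; tt)
open import Data.Vec.Functional using (Vector; _∷_; [])
open import Function.Base using (_∘_)
open import Level using (Level; _⊔_)
open import Relation.Binary.Bundles using (Poset)
import Relation.Binary.PropositionalEquality as ≡
open ≡ using (_≡_; _≢_)
import Relation.Binary.Reasoning.PartialOrder
open import Relation.Binary.Structures using (IsTotalOrder)
open import Relation.Nullary using (¬_; Dec; contradiction; yes; no; does)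
open import Relation.Nullary.Decidable using (_×-dec_; _⊎-dec_; ¬?; map′; dec-true; dec-false)
open import Relation.Unary using (Pred; Decidable; _∈_; _⊆_; _≐_)

-- All vertices are lattice points, so `H`, the widths and `M` are integers with decidable order.
-- The field `K` is met only through `ι`, which preserves and reflects `≤`; the planar argument runs
-- in ℤ, with convex combinations cleared of denominators. A minimal triple has to be found by a
-- finite search. Lattice width one forces a vertex with `x = 1`, and the hypothesis on `P₁` then
-- yields an interior lattice point of `P₀`. Hence every nonzero normal has positive width on `P₀`,
-- the width bounds the coordinates of the normal, and only finitely many pairs can compete with a
-- given one. The competition is among all pairs of nonzero determinant, not among bases, because
-- merging four normals guarantees no more than a nonzero determinant. Shrinking triangles brings
-- the minimum back to a basis. A dilate of the standard simplex is cut out by lower bounds on the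
-- coordinates and an upper bound on their sum, so a row `r` of the map has outer normal `- r`. This
-- is why the matrices are built from `⊟ a` and `⊟ b`.

module PlanarLattice where
  open import Data.Integer.Base using (_+_; _*_; _-_; -_; _≤_; _<_)
  open import Data.Integer.DivMod using (_%ℕ_; _/ℕ_; n%ℕd<d; a≡a%ℕn+[a/ℕn]*n)
  open import Data.Nat.Base using (ℕ)
  open import Relation.Binary.PropositionalEquality

  -- Reduces a linear inequality to a known one together with a ring identity, which the solver can
  -- prove.
  ≤-from-difference : ∀ {a b x y} → y - x ≡ b - a → a ≤ b → x ≤ y
  ≤-from-difference eq a≤b =
    ℤ.0≤i-j⇒j≤i (subst (0ℤ ≤_) (sym eq) (ℤ.i≤j⇒0≤j-i a≤b))

  *-mono-nonNeg : ∀ {k a b} → 0ℤ ≤ k → a ≤ b → k * a ≤ k * b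
  *-mono-nonNeg {+ k} {a} {b} _ a≤b = ℤ.*-monoˡ-≤-nonNeg (+ k) a≤b

  *-cancel-pos : ∀ {k a b} → 0ℤ < k → k * a ≤ k * b → a ≤ b
  *-cancel-pos {+[1+ k ]} {a} {b} _ = ℤ.*-cancelˡ-≤-pos a b +[1+ k ]
  *-cancel-pos {+ ℕ.zero} (+<+ ())

  -- Vectors of ℤ² and their determinants.

  ℤ² : Set
  ℤ² = ℤ × ℤ

  infixl 6 _⊞_
  infixr 7 _∙_ _⊡_
  infix 8 ⊟_

  _⊞_ : ℤ² → ℤ² → ℤ²
  (a , b) ⊞ (c , d) = a + c , b + d

  ⊟_ : ℤ² → ℤ²
  ⊟ (a , b) = - a , - b

  _⊡_ : ℤ → ℤ² → ℤ²
  k ⊡ (a , b) = k * a , k * b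

  _∙_ : ℤ² → ℤ² → ℤ
  (a , b) ∙ (c , d) = a * c + b * d

  det : ℤ² → ℤ² → ℤ
  det (a , b) (c , d) = a * d - b * c

  0² : ℤ²
  0² = 0ℤ , 0ℤ

  ⊟-involutive : ∀ g → ⊟ ⊟ g ≡ g
  ⊟-involutive (a , b) = cong₂ _,_ (ℤ.neg-involutive a) (ℤ.neg-involutive b)

  ⊟-≢0 : ∀ {g} → g ≢ 0² → ⊟ g ≢ 0²
  ⊟-≢0 {g} g≢0 ⊟g≡0 = g≢0 (trans (sym (⊟-involutive g)) (cong ⊟_ ⊟g≡0))

  ⊞-comm : ∀ g h → g ⊞ h ≡ h ⊞ g
  ⊞-comm (a , b) (c , d) = cong₂ _,_ (ℤ.+-comm a c) (ℤ.+-comm b d)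

  det-swap : ∀ g h → det h g ≡ - det g h
  det-swap (a , b) (c , d) = eq a b c d where
    eq : ∀ a b c d → c * b - d * a ≡ - (a * d - b * c)
    eq = solve-∀

  det-⊟ : ∀ g h → det (⊟ g) (⊟ h) ≡ det g h
  det-⊟ (a , b) (c , d) = eq a b c d where
    eq : ∀ a b c d → - a * - d - - b * - c ≡ a * d - b * c
    eq = solve-∀

  det-rotate : ∀ g h → det h (⊟ (g ⊞ h)) ≡ det g h
  det-rotate (a , b) (c , d) = eq a b c d where
    eq : ∀ a b c d → c * - (b + d) - d * - (a + c) ≡ a * d - b * c
    eq = solve-∀

  det≢0⇒≢0ˡ : ∀ g h → det g h ≢ 0ℤ → g ≢ 0²
  det≢0⇒≢0ˡ _ (c , d) det≢0 refl = det≢0 (eq c d) where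
    eq : ∀ c d → 0ℤ * d - 0ℤ * c ≡ 0ℤ
    eq = solve-∀

  boundedAny? : ∀ {p} {Q : ℤ → Set p} → (∀ z → Dec (Q z)) → ∀ B → Dec (∃ λ z → ∣ z ∣ ℕ.≤ B × Q z)
  boundedAny? {Q = Q} Q? B = map′ to from
    (ℕ.anyUpTo? (λ n → Q? (+ n) ⊎-dec Q? (- + n)) (ℕ.suc B))
    where
    to : (∃ λ n → n ℕ.< ℕ.suc B × (Q (+ n) ⊎ Q (- + n))) → ∃ λ z → ∣ z ∣ ℕ.≤ B × Q z
    to (n , n<B , inj₁ q) = + n , ℕ.s≤s⁻¹ n<B , q
    to (n , n<B , inj₂ q) = - + n , subst (ℕ._≤ B) (sym (ℤ.∣-i∣≡∣i∣ (+ n))) (ℕ.s≤s⁻¹ n<B) , q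
    from : (∃ λ z → ∣ z ∣ ℕ.≤ B × Q z) → ∃ λ n → n ℕ.< ℕ.suc B × (Q (+ n) ⊎ Q (- + n))
    from (+ n , n≤B , q) = n , ℕ.s≤s n≤B , inj₁ q
    from (-[1+ n ] , n≤B , q) = ℕ.suc n , ℕ.s≤s n≤B , inj₂ q

  Bounded : ℕ → ℤ² → Set
  Bounded B (a , b) = ∣ a ∣ ℕ.≤ B × ∣ b ∣ ℕ.≤ B

  boundedAny²? : ∀ {p} {Q : ℤ² → Set p} → (∀ g → Dec (Q g)) → ∀ B → Dec (∃ λ g → Bounded B g × Q g)
  boundedAny²? Q? B = map′
    (λ (a , a≤ , b , b≤ , q) → (a , b) , (a≤ , b≤) , q)
    (λ ((a , b) , (a≤ , b≤) , q) → a , a≤ , b , b≤ , q)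
    (boundedAny? (λ a → boundedAny? (λ b → Q? (a , b)) B) B)

  -- Support functions, widths and mixed volumes in the plane.

  module SupportFunction
    (I : Set) (u : I → ℤ²) (H : ℤ² → ℤ)
    (upper : ∀ g i → g ∙ u i ≤ H g)
    (attained : ∀ g → ∃[ i ] g ∙ u i ≡ H g)
    where

    -- Both sides are evaluated at a point where `g` attains its maximum. The multiplier `k`
    -- replaces division, so that rational combinations of normals can be used over ℤ.
    combine : ∀ k x y g a b → 0ℤ ≤ x → 0ℤ ≤ y →
              (∀ v → k * (g ∙ v) ≡ x * (a ∙ v) + y * (b ∙ v)) →
              k * H g ≤ x * H a + y * H b
    combine k x y g a b 0≤x 0≤y eq with attained g
    ... | i , g∙u≡H = begin
      k * H g                             ≡⟨ cong (k *_) g∙u≡H ⟨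
      k * (g ∙ u i)                       ≡⟨ eq (u i) ⟩
      x * (a ∙ u i) + y * (b ∙ u i)       ≤⟨ ℤ.+-mono-≤ (*-mono-nonNeg 0≤x (upper a i)) (*-mono-nonNeg 0≤y (upper b i)) ⟩
      x * H a + y * H b                   ∎
      where open ℤ.≤-Reasoning

    subadditive : ∀ g h → H (g ⊞ h) ≤ H g + H h
    subadditive g@(a , b) h@(c , d) = subst₂ _≤_ (ℤ.*-identityˡ (H (g ⊞ h)))
      (cong₂ _+_ (ℤ.*-identityˡ (H g)) (ℤ.*-identityˡ (H h)))
      (combine 1ℤ 1ℤ 1ℤ (g ⊞ h) g h (+≤+ ℕ.z≤n) (+≤+ ℕ.z≤n) (λ (x , y) → eq a b c d x y))
      where
      eq : ∀ a b c d x y → 1ℤ * ((a + c) * x + (b + d) * y) ≡ 1ℤ * (a * x + b * y) + 1ℤ * (c * x + d * y)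
      eq = solve-∀

    width : ℤ² → ℤ
    width g = H g + H (⊟ g)

    width-⊟ : ∀ g → width (⊟ g) ≡ width g
    width-⊟ g = trans (cong (λ z → H (⊟ g) + H z) (⊟-involutive g)) (ℤ.+-comm (H (⊟ g)) (H g))

    -- The triangle with outer normals a, b and c = - (a + b) has mixed volume
    -- M a b with the convex hull of the points u i.
    M : ℤ² → ℤ² → ℤ
    M a b = H a + H b + H (⊟ (a ⊞ b))

    M-swap : ∀ a b → M b a ≡ M a b
    M-swap a b = cong₂ _+_ (ℤ.+-comm (H b) (H a)) (cong (λ g → H (⊟ g)) (⊞-comm b a))

    M-rotate : ∀ a b → M b (⊟ (a ⊞ b)) ≡ M a b
    M-rotate a@(a₁ , a₂) b@(b₁ , b₂) = trans (cong (λ g → H b + H (⊟ (a ⊞ b)) + H g) (cong₂ _,_ (eq a₁ b₁) (eq a₂ b₂))) (eq′ (H a) (H b) (H (⊟ (a ⊞ b))))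
      where
      eq : ∀ x y → - (y + - (x + y)) ≡ x
      eq = solve-∀
      eq′ : ∀ x y z → y + z + x ≡ x + y + z
      eq′ = solve-∀

    -- `- a` is the sum of the other two normals, so `H (⊟ a)` is at most the sum of their supports.
    -- This bound later confines competing pairs to a finite box.
    width≤M : ∀ a b → width a ≤ M a b
    width≤M a@(a₁ , a₂) b@(b₁ , b₂) = begin
      H a + H (⊟ a)                         ≡⟨ cong (λ g → H a + H g) (cong₂ _,_ (eq a₁ b₁) (eq a₂ b₂)) ⟩
      H a + H (b ⊞ ⊟ (a ⊞ b))               ≤⟨ ℤ.+-monoʳ-≤ (H a) (subadditive b (⊟ (a ⊞ b))) ⟩
      H a + (H b + H (⊟ (a ⊞ b)))           ≡⟨ ℤ.+-assoc (H a) (H b) _ ⟨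
      M a b                                 ∎
      where
      open ℤ.≤-Reasoning
      eq : ∀ x y → - x ≡ y + - (x + y)
      eq = solve-∀

    width-nonNeg : ∀ g → 0ℤ ≤ width g
    width-nonNeg g@(a , b) with attained g
    ... | i , g∙u≡H = subst (_≤ width g) (eq a b (proj₁ (u i)) (proj₂ (u i))) (ℤ.+-mono-≤ (upper g i) (upper (⊟ g) i))
      where
      eq : ∀ a b x y → (a * x + b * y) + (- a * x + - b * y) ≡ 0ℤ
      eq = solve-∀

    M-nonNeg : ∀ a b → 0ℤ ≤ M a b
    M-nonNeg a b = ℤ.≤-trans (width-nonNeg a) (width≤M a b)

    -- Replaces the triangle with edges a, b by one with edges a, m that it
    -- contains: m ends at the point with barycentric numerators s, t.
    subtriangle : ∀ {D} a b m → 0ℤ < D → det a b ≡ D →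
      0ℤ ≤ det b m → 0ℤ ≤ det a m → det b m + det a m ≤ D →
      M a m ≤ M a b
    subtriangle {D} a@(a₁ , a₂) b@(b₁ , b₂) m@(m₁ , m₂) 0<D refl 0≤s 0≤t s+t≤D =
      ≤-from-difference (eq₀ (H a) (H b) (H c) (H m) (H n)) Hm+Hn≤Hb+Hc
      where
      c = ⊟ (a ⊞ b)
      n = ⊟ (a ⊞ m)
      s = det b m
      t = det a m
      eq₀ : ∀ A B C X Y → (A + B + C) - (A + X + Y) ≡ (B + C) - (X + Y)
      eq₀ = solve-∀
      eq-m : ∀ a₁ a₂ b₁ b₂ m₁ m₂ x y →
        (a₁ * b₂ - a₂ * b₁) * (m₁ * x + m₂ * y) ≡
        ((b₁ * m₂ - b₂ * m₁) + (a₁ * m₂ - a₂ * m₁)) * (b₁ * x + b₂ * y) +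
        (b₁ * m₂ - b₂ * m₁) * (- (a₁ + b₁) * x + - (a₂ + b₂) * y)
      eq-m = solve-∀
      eq-n : ∀ a₁ a₂ b₁ b₂ m₁ m₂ x y →
        (a₁ * b₂ - a₂ * b₁) * (- (a₁ + m₁) * x + - (a₂ + m₂) * y) ≡
        ((a₁ * b₂ - a₂ * b₁) - ((b₁ * m₂ - b₂ * m₁) + (a₁ * m₂ - a₂ * m₁))) * (b₁ * x + b₂ * y) +
        ((a₁ * b₂ - a₂ * b₁) - (b₁ * m₂ - b₂ * m₁)) * (- (a₁ + b₁) * x + - (a₂ + b₂) * y)
      eq-n = solve-∀
      s≤D : s ≤ det a b
      s≤D = ℤ.≤-trans (subst (_≤ s + t) (ℤ.+-identityʳ s) (ℤ.+-monoʳ-≤ s 0≤t)) s+t≤D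
      -- As `- a = b + c`, one has `D m = (s + t) b + s c` and `D n = (D - s - t) b + (D - s) c`.
      -- All coefficients are nonnegative, and those of `b` and of `c` each add up to `D`.
      Dm : D * H m ≤ (s + t) * H b + s * H c
      Dm = combine D (s + t) s m b c (ℤ.+-mono-≤ 0≤s 0≤t) 0≤s (λ (x , y) → eq-m a₁ a₂ b₁ b₂ m₁ m₂ x y)
      Dn : D * H n ≤ (D - (s + t)) * H b + (D - s) * H c
      Dn = combine D (D - (s + t)) (D - s) n b c (ℤ.i≤j⇒0≤j-i s+t≤D) (ℤ.i≤j⇒0≤j-i s≤D) (λ (x , y) → eq-n a₁ a₂ b₁ b₂ m₁ m₂ x y)
      eq₁ : ∀ D B C X Y s r → D * (B + C) - D * (X + Y) ≡ (r * B + s * C + ((D - r) * B + (D - s) * C)) - (D * X + D * Y)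
      eq₁ = solve-∀
      Hm+Hn≤Hb+Hc : H m + H n ≤ H b + H c
      Hm+Hn≤Hb+Hc = *-cancel-pos 0<D (≤-from-difference (eq₁ D (H b) (H c) (H m) (H n) s (s + t)) (ℤ.+-mono-≤ Dm Dn))

    -- Shrinking a lattice triangle to a unimodular one.

    Smaller : ℤ² → ℤ² → ℕ → Set
    Smaller a b D = ∃[ a′ ] ∃[ b′ ] det a′ b′ ≢ 0ℤ × ∣ det a′ b′ ∣ ℕ.< D × M a′ b′ ≤ M a b

    -- The point reflection from `m` to `b - a - m` swaps the two halves of the parallelogram
    -- spanned by `- a` and `b` and turns `s`, `t` into `D - s`, `D - t`. So one of the two vectors
    -- meets the condition `s + t ≤ D` of `subtriangle`, and `0 < t < D` keeps the new determinant
    -- nonzero and below `D`.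
    shrink-at : ∀ {D s t} a b m → det a b ≡ + D → det b m ≡ + s → det a m ≡ + t →
                0 ℕ.< t → t ℕ.< D → s ℕ.< D → Smaller a b D
    shrink-at {D} {s} {t} a@(a₁ , a₂) b@(b₁ , b₂) m@(m₁ , m₂) det≡D det≡s det≡t 0<t t<D s<D
      with s ℕ.+ t ℕ.≤? D
    ... | yes s+t≤D = a , m ,
      (λ det≡0 → ℕ.<⇒≢ 0<t (sym (ℤ.+-injective (trans (sym det≡t) det≡0)))) ,
      subst (ℕ._< D) (sym (cong ∣_∣ det≡t)) t<D ,
      subtriangle a b m (+<+ (ℕ.<-trans 0<t t<D)) det≡D
        (subst (0ℤ ≤_) (sym det≡s) (+≤+ ℕ.z≤n)) (subst (0ℤ ≤_) (sym det≡t) (+≤+ ℕ.z≤n))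
        (subst (_≤ + D) (sym (cong₂ _+_ det≡s det≡t)) (+≤+ s+t≤D))
    ... | no s+t≰D = a , m′ ,
      (λ det≡0 → ℕ.<⇒≢ (ℕ.m<n⇒0<n∸m t<D) (sym (ℤ.+-injective (trans (sym det≡t′) det≡0)))) ,
      subst (ℕ._< D) (sym (cong ∣_∣ det≡t′)) (ℕ.∸-monoʳ-< 0<t (ℕ.<⇒≤ t<D)) ,
      subtriangle a b m′ (+<+ (ℕ.<-trans 0<t t<D)) det≡D
        (subst (0ℤ ≤_) (sym det≡s′) (+≤+ ℕ.z≤n)) (subst (0ℤ ≤_) (sym det≡t′) (+≤+ ℕ.z≤n))
        (subst (_≤ + D) (sym (cong₂ _+_ det≡s′ det≡t′)) (+≤+ s′+t′≤D))
      where
      m′ = b ⊞ ⊟ (a ⊞ m)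
      complement : ∀ {k} → k ℕ.< D → + D - + k ≡ + (D ℕ.∸ k)
      complement {k} k<D = trans (ℤ.m-n≡m⊖n D k) (ℤ.⊖-≥ (ℕ.<⇒≤ k<D))
      eq-t : ∀ a₁ a₂ b₁ b₂ m₁ m₂ → a₁ * (b₂ + - (a₂ + m₂)) - a₂ * (b₁ + - (a₁ + m₁)) ≡
             (a₁ * b₂ - a₂ * b₁) - (a₁ * m₂ - a₂ * m₁)
      eq-t = solve-∀
      eq-s : ∀ a₁ a₂ b₁ b₂ m₁ m₂ → b₁ * (b₂ + - (a₂ + m₂)) - b₂ * (b₁ + - (a₁ + m₁)) ≡
             (a₁ * b₂ - a₂ * b₁) - (b₁ * m₂ - b₂ * m₁)
      eq-s = solve-∀
      det≡t′ : det a m′ ≡ + (D ℕ.∸ t)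
      det≡t′ = trans (trans (eq-t a₁ a₂ b₁ b₂ m₁ m₂) (cong₂ _-_ det≡D det≡t)) (complement t<D)
      det≡s′ : det b m′ ≡ + (D ℕ.∸ s)
      det≡s′ = trans (trans (eq-s a₁ a₂ b₁ b₂ m₁ m₂) (cong₂ _-_ det≡D det≡s)) (complement s<D)
      s′+t′≤D : (D ℕ.∸ s) ℕ.+ (D ℕ.∸ t) ℕ.≤ D
      s′+t′≤D = begin
        (D ℕ.∸ s) ℕ.+ (D ℕ.∸ t)   ≤⟨ ℕ.+-monoˡ-≤ (D ℕ.∸ t) (ℕ.m≤n+o⇒m∸n≤o D s (ℕ.<⇒≤ (ℕ.≰⇒> s+t≰D))) ⟩
        t ℕ.+ (D ℕ.∸ t)           ≡⟨ ℕ.m+[n∸m]≡n (ℕ.<⇒≤ t<D) ⟩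
        D                         ∎
        where open ℕ.≤-Reasoning

    -- Adding multiples of `a` and of `b` to `m` changes `det b m` and `det a m` independently by
    -- multiples of `D`, so both can be replaced by their remainders.
    shrink-modulo : ∀ {D} .{{_ : ℕ.NonZero D}} a b m → det a b ≡ + D → det a m %ℕ D ≢ 0 → Smaller a b D
    shrink-modulo {D} a@(a₁ , a₂) b@(b₁ , b₂) m@(m₁ , m₂) det≡D t≢0 =
      shrink-at a b (m ⊞ (- q) ⊡ b ⊞ p ⊡ a) det≡D
        (trans (eq-s a₁ a₂ b₁ b₂ m₁ m₂ p q) (remainder (det b m)))
        (trans (eq-t a₁ a₂ b₁ b₂ m₁ m₂ p q) (remainder (det a m)))
        (ℕ.n≢0⇒n>0 t≢0) (n%ℕd<d (det a m) D) (n%ℕd<d (det b m) D)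
      where
      p = det b m /ℕ D
      q = det a m /ℕ D
      eq-t : ∀ a₁ a₂ b₁ b₂ m₁ m₂ p q →
        a₁ * (m₂ + - q * b₂ + p * a₂) - a₂ * (m₁ + - q * b₁ + p * a₁) ≡
        (a₁ * m₂ - a₂ * m₁) - q * (a₁ * b₂ - a₂ * b₁)
      eq-t = solve-∀
      eq-s : ∀ a₁ a₂ b₁ b₂ m₁ m₂ p q →
        b₁ * (m₂ + - q * b₂ + p * a₂) - b₂ * (m₁ + - q * b₁ + p * a₁) ≡
        (b₁ * m₂ - b₂ * m₁) - p * (a₁ * b₂ - a₂ * b₁)
      eq-s = solve-∀
      eq-r : ∀ r x → (r + x) - x ≡ r
      eq-r = solve-∀
      remainder : ∀ z → z - (z /ℕ D) * det a b ≡ + (z %ℕ D)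
      remainder z = trans (cong₂ (λ x y → x - (z /ℕ D) * y) (a≡a%ℕn+[a/ℕn]*n z D) det≡D)
        (eq-r (+ (z %ℕ D)) ((z /ℕ D) * + D))

    e₁ e₂ : ℤ²
    e₁ = 1ℤ , 0ℤ
    e₂ = 0ℤ , 1ℤ

    multiple : ∀ {D} .{{_ : ℕ.NonZero D}} z → z %ℕ D ≡ 0 → z ≡ (z /ℕ D) * + D
    multiple {D} z z%D≡0 = trans (a≡a%ℕn+[a/ℕn]*n z D)
      (trans (cong (λ r → + r + (z /ℕ D) * + D) z%D≡0) (ℤ.+-identityˡ _))

    -- The four determinants are the coordinates of `a` and `b` up to sign. If `D` divides them all,
    -- its square divides `det a b`, which is `D` itself.
    coprime-coordinates : ∀ {D} x y z w a b → 1 ℕ.< D → det a b ≡ + D →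
      det a e₁ ≡ x * + D → det a e₂ ≡ y * + D → det b e₁ ≡ z * + D → det b e₂ ≡ w * + D → ⊥
    coprime-coordinates {D} x y z w a@(a₁ , a₂) b@(b₁ , b₂) 1<D det≡D p q r s =
      ℕ.<⇒≢ 1<D (sym (ℕ.m*n≡1⇒m≡1 D ∣ k ∣ (trans (sym (ℤ.abs-* (+ D) k)) (cong ∣_∣ (sym 1≡Dk)))))
      where
      k = x * w - y * z
      eq : ∀ a₁ a₂ b₁ b₂ → a₁ * b₂ - a₂ * b₁ ≡
        (a₁ * 0ℤ - a₂ * 1ℤ) * (b₁ * 1ℤ - b₂ * 0ℤ) - (a₁ * 1ℤ - a₂ * 0ℤ) * (b₁ * 0ℤ - b₂ * 1ℤ)
      eq = solve-∀
      eq′ : ∀ x y z w d → x * d * (w * d) - y * d * (z * d) ≡ d * (d * (x * w - y * z))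
      eq′ = solve-∀
      D≡DDk : + D ≡ + D * (+ D * k)
      D≡DDk = trans (trans (sym det≡D) (eq a₁ a₂ b₁ b₂))
        (trans (cong₂ _-_ (cong₂ _*_ p s) (cong₂ _*_ q r)) (eq′ x y z w (+ D)))
      1≡Dk : 1ℤ ≡ + D * k
      1≡Dk = ℤ.*-cancelˡ-≡ (+ D) 1ℤ (+ D * k) {{ℕ.>-nonZero (ℕ.<-trans ℕ.z<s 1<D)}}
        (trans (ℤ.*-identityʳ (+ D)) D≡DDk)

    -- Some coordinate of `a` or `b` is not divisible by `D`, so a unit vector can serve as `m`. If
    -- the coordinate belongs to `b`, the triangle is rotated to make `b` its first edge.
    shrink⁺ : ∀ {D} .{{_ : ℕ.NonZero D}} a b → 1 ℕ.< D → det a b ≡ + D → Smaller a b D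
    shrink⁺ {D} a b 1<D det≡D = cases
      (det a e₁ %ℕ D ℕ.≟ 0) (det a e₂ %ℕ D ℕ.≟ 0) (det b e₁ %ℕ D ℕ.≟ 0) (det b e₂ %ℕ D ℕ.≟ 0)
      where
      rotated : ∀ m → det b m %ℕ D ≢ 0 → Smaller a b D
      rotated m ≢0 =
        let a′ , b′ , p , q , M≤ = shrink-modulo b (⊟ (a ⊞ b)) m (trans (det-rotate a b) det≡D) ≢0
        in a′ , b′ , p , q , subst (M a′ b′ ≤_) (M-rotate a b) M≤
      cases : Dec (det a e₁ %ℕ D ≡ 0) → Dec (det a e₂ %ℕ D ≡ 0) →
              Dec (det b e₁ %ℕ D ≡ 0) → Dec (det b e₂ %ℕ D ≡ 0) → Smaller a b D
      cases (no ≢0) _ _ _ = shrink-modulo a b e₁ det≡D ≢0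
      cases _ (no ≢0) _ _ = shrink-modulo a b e₂ det≡D ≢0
      cases _ _ (no ≢0) _ = rotated e₁ ≢0
      cases _ _ _ (no ≢0) = rotated e₂ ≢0
      cases (yes p) (yes q) (yes r) (yes s) = ⊥-elim (coprime-coordinates
        (det a e₁ /ℕ D) (det a e₂ /ℕ D) (det b e₁ /ℕ D) (det b e₂ /ℕ D) a b 1<D det≡D
        (multiple (det a e₁) p) (multiple (det a e₂) q) (multiple (det b e₁) r) (multiple (det b e₂) s))

    shrink : ∀ a b → 1 ℕ.< ∣ det a b ∣ → Smaller a b ∣ det a b ∣
    shrink a b 1<∣det∣ with det a b in eq
    ... | +[1+ D ] = shrink⁺ a b 1<∣det∣ eq
    ... | -[1+ D ] with shrink⁺ b a 1<∣det∣ (trans (det-swap a b) (cong -_ eq))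
    ...   | a′ , b′ , p , q , M≤ = a′ , b′ , p , q , subst (M a′ b′ ≤_) (M-swap a b) M≤

    unimodularise : ∀ n a b → det a b ≢ 0ℤ → ∣ det a b ∣ ℕ.≤ n →
      ∃[ a′ ] ∃[ b′ ] ∣ det a′ b′ ∣ ≡ 1 × M a′ b′ ≤ M a b
    unimodularise ℕ.zero a b det≢0 ∣det∣≤n =
      contradiction (ℤ.∣i∣≡0⇒i≡0 (ℕ.n≤0⇒n≡0 ∣det∣≤n)) det≢0
    unimodularise (ℕ.suc n) a b det≢0 ∣det∣≤n with ∣ det a b ∣ ℕ.≟ 1
    ... | yes ∣det∣≡1 = a , b , ∣det∣≡1 , ℤ.≤-refl
    ... | no ∣det∣≢1 with shrink a b (ℕ.≤∧≢⇒< (ℕ.n≢0⇒n>0 (det≢0 ∘ ℤ.∣i∣≡0⇒i≡0)) (∣det∣≢1 ∘ sym))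
    ...   | a₁ , b₁ , det₁≢0 , det₁< , M₁≤ with unimodularise n a₁ b₁ det₁≢0 (ℕ.s≤s⁻¹ (ℕ.≤-trans det₁< ∣det∣≤n))
    ...     | a₂ , b₂ , ∣det₂∣≡1 , M₂≤ = a₂ , b₂ , ∣det₂∣≡1 , ℤ.≤-trans M₂≤ M₁≤

    -- Minimal triples and reduced pairs.

    Minimal : ℤ² → ℤ² → Set
    Minimal a b = ∣ det a b ∣ ≡ 1 × (∀ a′ b′ → det a′ b′ ≢ 0ℤ → M a b ≤ M a′ b′)

    swap-minimal : ∀ {a b} → Minimal a b → Minimal b a
    swap-minimal {a} {b} (∣det∣≡1 , least) =
      trans (trans (cong ∣_∣ (det-swap a b)) (ℤ.∣-i∣≡∣i∣ (det a b))) ∣det∣≡1 ,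
      λ a′ b′ det≢0 → subst (_≤ M a′ b′) (sym (M-swap a b)) (least a′ b′ det≢0)

    rotate-minimal : ∀ {a b} → Minimal a b → Minimal b (⊟ (a ⊞ b))
    rotate-minimal {a} {b} (∣det∣≡1 , least) =
      trans (cong ∣_∣ (det-rotate a b)) ∣det∣≡1 ,
      λ a′ b′ det≢0 → subst (_≤ M a′ b′) (sym (M-rotate a b)) (least a′ b′ det≢0)

    ∣det∣≡1⇒det≢0 : ∀ a b → ∣ det a b ∣ ≡ 1 → det a b ≢ 0ℤ
    ∣det∣≡1⇒det≢0 a b ∣det∣≡1 det≡0 with trans (sym ∣det∣≡1) (cong ∣_∣ det≡0)
    ... | ()

    ≤-width-difference : ∀ {a b} → Minimal a b → width b ≤ width (a ⊞ ⊟ b)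
    ≤-width-difference {a@(a₁ , a₂)} {b@(b₁ , b₂)} (∣det∣≡1 , least) =
      ≤-from-difference (eq (H a) (H b) (H (⊟ b)) (H (⊟ (a ⊞ b))) (H (a ⊞ ⊟ b)) (H (⊟ (a ⊞ ⊟ b))))
        (ℤ.+-mono-≤ (least a (⊟ b) det≢0) 2Hb)
      where
      det≢0 : det a (⊟ b) ≢ 0ℤ
      det≢0 det≡0 = ∣det∣≡1⇒det≢0 a b ∣det∣≡1 (trans (eq₀ a₁ a₂ b₁ b₂) (cong -_ det≡0)) where
        eq₀ : ∀ a₁ a₂ b₁ b₂ → a₁ * b₂ - a₂ * b₁ ≡ - (a₁ * - b₂ - a₂ * - b₁)
        eq₀ = solve-∀
      -- The normals `- (a + b)` and `a - b` add up to `- 2 b`. Added to the minimality inequality,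
      -- this cancels `H (⊟ (a ⊞ b))` and leaves only the two widths.
      2Hb : + 2 * H (⊟ b) ≤ 1ℤ * H (⊟ (a ⊞ b)) + 1ℤ * H (a ⊞ ⊟ b)
      2Hb = combine (+ 2) 1ℤ 1ℤ (⊟ b) (⊟ (a ⊞ b)) (a ⊞ ⊟ b) (+≤+ ℕ.z≤n) (+≤+ ℕ.z≤n) λ (x , y) → eq₁ a₁ a₂ b₁ b₂ x y
        where
        eq₁ : ∀ a₁ a₂ b₁ b₂ x y → + 2 * (- b₁ * x + - b₂ * y) ≡
          1ℤ * (- (a₁ + b₁) * x + - (a₂ + b₂) * y) + 1ℤ * ((a₁ + - b₁) * x + (a₂ + - b₂) * y)
        eq₁ = solve-∀
      eq : ∀ a b b′ s d d′ → d + d′ - (b + b′) ≡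
        (a + b′ + d′ + (1ℤ * s + 1ℤ * d)) - (a + b + s + + 2 * b′)
      eq = solve-∀

    -- The width is a convex function of n along n ⊡ a ⊞ b.
    width-along-line : ∀ n a b → width b ≤ width (a ⊞ b) → width b ≤ width (+ n ⊡ a ⊞ b)
    width-along-line ℕ.zero (a₁ , a₂) (b₁ , b₂) _ = ℤ.≤-reflexive (cong width
      (cong₂ _,_ (sym (ℤ.+-identityˡ b₁)) (sym (ℤ.+-identityˡ b₂))))
    width-along-line (ℕ.suc n) a@(a₁ , a₂) b@(b₁ , b₂) h = ≤-from-difference
      (eq (+ n) (H b) (H (⊟ b)) (H (a ⊞ b)) (H (⊟ (a ⊞ b))) (H g) (H (⊟ g)))
      (ℤ.+-mono-≤ (*-mono-nonNeg {+ ℕ.suc n} (+≤+ ℕ.z≤n) h)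
        (ℤ.+-mono-≤
          (combine (+ ℕ.suc n) 1ℤ (+ n) (a ⊞ b) g b (+≤+ ℕ.z≤n) (+≤+ ℕ.z≤n) λ (x , y) → eq⁺ (+ n) a₁ a₂ b₁ b₂ x y)
          (combine (+ ℕ.suc n) 1ℤ (+ n) (⊟ (a ⊞ b)) (⊟ g) (⊟ b) (+≤+ ℕ.z≤n) (+≤+ ℕ.z≤n) λ (x , y) → eq⁻ (+ n) a₁ a₂ b₁ b₂ x y)))
      where
      g = + ℕ.suc n ⊡ a ⊞ b
      eq⁺ : ∀ n a₁ a₂ b₁ b₂ x y → (1ℤ + n) * ((a₁ + b₁) * x + (a₂ + b₂) * y) ≡
        1ℤ * (((1ℤ + n) * a₁ + b₁) * x + ((1ℤ + n) * a₂ + b₂) * y) + n * (b₁ * x + b₂ * y)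
      eq⁺ = solve-∀
      eq⁻ : ∀ n a₁ a₂ b₁ b₂ x y → (1ℤ + n) * (- (a₁ + b₁) * x + - (a₂ + b₂) * y) ≡
        1ℤ * (- ((1ℤ + n) * a₁ + b₁) * x + - ((1ℤ + n) * a₂ + b₂) * y) + n * (- b₁ * x + - b₂ * y)
      eq⁻ = solve-∀
      eq : ∀ n b b′ s s′ g g′ → (g + g′) - (b + b′) ≡
        ((1ℤ + n) * (s + s′) + ((1ℤ * g + n * b) + (1ℤ * g′ + n * b′))) -
        ((1ℤ + n) * (b + b′) + ((1ℤ + n) * s + (1ℤ + n) * s′))
      eq = solve-∀

    -- Since widths are even functions, this orders the widths of `a`, `b` and the third normal
    -- `⊟ (a ⊞ b)`.
    Reduced : ℤ² → ℤ² → Set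
    Reduced a b = width a ≤ width b × width b ≤ width (a ⊞ b)

    -- Convexity along the line takes one initial step in each direction: `Reduced` controls
    -- `a ⊞ b`, and minimality controls `⊟ a ⊞ b` through `≤-width-difference`.
    reduced : ∀ {a b} → Minimal a b → Reduced a b → ∀ n → width b ≤ width (n ⊡ a ⊞ b)
    reduced {a} {b} _ (_ , h) (+ n) = width-along-line n a b h
    reduced {a@(a₁ , a₂)} {b@(b₁ , b₂)} min _ -[1+ n ] =
      subst (λ g → width b ≤ width g)
        (cong₂ _,_ (eq (+ ℕ.suc n) a₁ b₁) (eq (+ ℕ.suc n) a₂ b₂))
        (width-along-line (ℕ.suc n) (⊟ a) b
          (subst (width b ≤_) (trans (sym (width-⊟ (a ⊞ ⊟ b))) (cong width (cong₂ _,_ (eq′ a₁ b₁) (eq′ a₂ b₂))))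
            (≤-width-difference min)))
      where
      eq : ∀ n x y → n * - x + y ≡ - n * x + y
      eq = solve-∀
      eq′ : ∀ x y → - (x + - y) ≡ - x + y
      eq′ = solve-∀

    -- Any two of the three normals form a minimal pair with the same `M`. When the two of least
    -- width are kept, the third, minus their sum, is the widest.
    sort₃ : ∀ {a b} → Minimal a b → width a ≤ width b → ∃[ p ] ∃[ q ] Minimal p q × Reduced p q
    sort₃ {a} {b} min a≤b = cases (ℤ.≤-total (width b) (width c)) (ℤ.≤-total (width a) (width c))
      where
      c = ⊟ (a ⊞ b)
      width-c+a : width (c ⊞ a) ≡ width b
      width-c+a = trans (cong width (cong₂ _,_ (eq (proj₁ a) (proj₁ b)) (eq (proj₂ a) (proj₂ b)))) (width-⊟ b) where
        eq : ∀ x y → - (x + y) + x ≡ - y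
        eq = solve-∀
      c-a-minimal : Minimal c a
      c-a-minimal = subst (Minimal c) (cong₂ _,_ (eq (proj₁ a) (proj₁ b)) (eq (proj₂ a) (proj₂ b)))
        (rotate-minimal (rotate-minimal min))
        where
        eq : ∀ x y → - (y + - (x + y)) ≡ x
        eq = solve-∀
      cases : width b ≤ width c ⊎ width c ≤ width b → width a ≤ width c ⊎ width c ≤ width a →
              ∃[ p ] ∃[ q ] Minimal p q × Reduced p q
      cases (inj₁ b≤c) _ = a , b , min , a≤b , subst (width b ≤_) (width-⊟ (a ⊞ b)) b≤c
      cases (inj₂ c≤b) (inj₁ a≤c) = a , c , swap-minimal (c-a-minimal) , a≤c ,
        subst (width c ≤_) (trans (sym width-c+a) (cong width (⊞-comm c a))) c≤b
      cases (inj₂ c≤b) (inj₂ c≤a) = c , a , c-a-minimal , c≤a ,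
        subst (width a ≤_) (sym width-c+a) a≤b

    sort : ∀ {a b} → Minimal a b → ∃[ p ] ∃[ q ] Minimal p q × Reduced p q
    sort {a} {b} min = [ sort₃ min , sort₃ (swap-minimal min) ]′ (ℤ.≤-total (width a) (width b))

    -- Merging four normals of sum zero.

    merge-last : ∀ {a b} → Minimal a b → ∀ p q r → det p q ≢ 0ℤ →
      M a b ≤ H p + H q + H r + H (⊟ (p ⊞ q ⊞ r))
    merge-last {a} {b} (_ , least) p q r det≢0 = begin
      M a b                                          ≤⟨ least p q det≢0 ⟩
      H p + H q + H (⊟ (p ⊞ q))                      ≡⟨ cong (λ g → H p + H q + H g) (cong₂ _,_
        (eq (proj₁ p) (proj₁ q) (proj₁ r)) (eq (proj₂ p) (proj₂ q) (proj₂ r))) ⟩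
      H p + H q + H (r ⊞ ⊟ (p ⊞ q ⊞ r))              ≤⟨ ℤ.+-monoʳ-≤ (H p + H q) (subadditive r (⊟ (p ⊞ q ⊞ r))) ⟩
      H p + H q + (H r + H (⊟ (p ⊞ q ⊞ r)))          ≡⟨ ℤ.+-assoc (H p + H q) (H r) _ ⟨
      H p + H q + H r + H (⊟ (p ⊞ q ⊞ r))            ∎
      where
      open ℤ.≤-Reasoning
      eq : ∀ x y z → - (x + y) ≡ z + - (x + y + z)
      eq = solve-∀

    rotate-sum : ∀ p q r → H q + H r + H p + H (⊟ (q ⊞ r ⊞ p)) ≡ H p + H q + H r + H (⊟ (p ⊞ q ⊞ r))
    rotate-sum p q r = cong₂ _+_ (eq (H p) (H q) (H r)) (cong (λ g → H (⊟ g))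
      (cong₂ _,_ (eq (proj₁ p) (proj₁ q) (proj₁ r)) (eq (proj₂ p) (proj₂ q) (proj₂ r))))
      where
      eq : ∀ x y z → y + z + x ≡ x + y + z
      eq = solve-∀

    -- By subadditivity, replacing two of the four normals by their sum does not increase the total
    -- support. The pair to keep is one with nonzero determinant; the rotations bring it to the
    -- front.
    merge : ∀ {a b} → Minimal a b → ∀ p q r → det p q ≢ 0ℤ ⊎ det q r ≢ 0ℤ ⊎ det r p ≢ 0ℤ →
      M a b ≤ H p + H q + H r + H (⊟ (p ⊞ q ⊞ r))
    merge min p q r (inj₁ det≢0) = merge-last min p q r det≢0
    merge {a} {b} min p q r (inj₂ (inj₁ det≢0)) = subst (M a b ≤_) (rotate-sum p q r) (merge-last min q r p det≢0)
    merge {a} {b} min p q r (inj₂ (inj₂ det≢0)) = subst (M a b ≤_) (trans (rotate-sum q r p) (rotate-sum p q r)) (merge-last min r p q det≢0)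

    -- Existence of a minimal pair.

    module Minimisation (width-pos : ∀ g → g ≢ 0² → 0ℤ < width g) where

      perp : ℤ² → ℤ²
      perp (x , y) = - y , x

      -- Extremal points for `e₁` give a nonzero `d`. Pairing with `perp d` is `det d`, so the
      -- positive width of `perp d` is a difference of two determinants based at `u i`, which cannot
      -- both vanish.
      noncollinear : ∃[ i ] ∃[ j ] ∃[ k ] det (u j ⊞ ⊟ u i) (u k ⊞ ⊟ u i) ≢ 0ℤ
      noncollinear = cases (det d (u k ⊞ ⊟ u i) ℤ.≟ 0ℤ) (det d (u l ⊞ ⊟ u i) ℤ.≟ 0ℤ)
        where
        j = proj₁ (attained e₁)
        i = proj₁ (attained (⊟ e₁))
        d = u j ⊞ ⊟ u i
        g = perp d
        k = proj₁ (attained g)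
        l = proj₁ (attained (⊟ g))
        width-attained : ∀ g → width g ≡ g ∙ u (proj₁ (attained g)) + ⊟ g ∙ u (proj₁ (attained (⊟ g)))
        width-attained g = sym (cong₂ _+_ (proj₂ (attained g)) (proj₂ (attained (⊟ g))))
        eq : ∀ d₁ d₂ i₁ i₂ k₁ k₂ l₁ l₂ → (- d₂ * k₁ + d₁ * k₂) + (- - d₂ * l₁ + - d₁ * l₂) ≡
          (d₁ * (k₂ + - i₂) - d₂ * (k₁ + - i₁)) - (d₁ * (l₂ + - i₂) - d₂ * (l₁ + - i₁))
        eq = solve-∀
        eq′ : ∀ j₁ j₂ i₁ i₂ → (1ℤ * j₁ + 0ℤ * j₂) + (- 1ℤ * i₁ + - 0ℤ * i₂) ≡ j₁ + - i₁
        eq′ = solve-∀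
        g≢0 : g ≢ 0²
        g≢0 g≡0 = ℤ.<⇒≢ (width-pos e₁ λ ()) (sym (trans (width-attained e₁)
          (trans (eq′ (proj₁ (u j)) (proj₂ (u j)) (proj₁ (u i)) (proj₂ (u i))) (cong proj₂ g≡0))))
        cases : Dec (det d (u k ⊞ ⊟ u i) ≡ 0ℤ) → Dec (det d (u l ⊞ ⊟ u i) ≡ 0ℤ) →
                ∃[ i ] ∃[ j ] ∃[ k ] det (u j ⊞ ⊟ u i) (u k ⊞ ⊟ u i) ≢ 0ℤ
        cases (no k≢0) _ = i , j , k , k≢0
        cases _ (no l≢0) = i , j , l , l≢0
        cases (yes k≡0) (yes l≡0) = contradiction (trans (width-attained g)
          (trans (eq (proj₁ d) (proj₂ d) (proj₁ (u i)) (proj₂ (u i)) (proj₁ (u k)) (proj₂ (u k)) (proj₁ (u l)) (proj₂ (u l)))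
            (cong₂ _-_ k≡0 l≡0))) (ℤ.<⇒≢ (width-pos g g≢0) ∘ sym)

      ∣∣-bound : ∀ {x y} → x ≤ y → - x ≤ y → ∣ x ∣ ℕ.≤ ∣ y ∣
      ∣∣-bound {+ _} (+≤+ x≤y) _ = x≤y
      ∣∣-bound { -[1+ _ ]} _ (+≤+ -x≤y) = -x≤y

      spread-bound : ∀ g i j → ∣ g ∙ (u j ⊞ ⊟ u i) ∣ ℕ.≤ ∣ width g ∣
      spread-bound g@(a , b) i j = ∣∣-bound
        (subst (_≤ width g) (eq a b (proj₁ (u i)) (proj₂ (u i)) (proj₁ (u j)) (proj₂ (u j))) (ℤ.+-mono-≤ (upper g j) (upper (⊟ g) i)))
        (subst (_≤ width g) (eq′ a b (proj₁ (u i)) (proj₂ (u i)) (proj₁ (u j)) (proj₂ (u j))) (ℤ.+-mono-≤ (upper g i) (upper (⊟ g) j)))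
        where
        eq : ∀ a b x y z w → (a * z + b * w) + (- a * x + - b * y) ≡ a * (z + - x) + b * (w + - y)
        eq = solve-∀
        eq′ : ∀ a b x y z w → (a * x + b * y) + (- a * z + - b * w) ≡ - (a * (z + - x) + b * (w + - y))
        eq′ = solve-∀

      scaled-bound : ∀ {W} D Y Z x p q → D ≢ 0ℤ → D * x ≡ Y * p - Z * q →
        ∣ Y ∣ ℕ.≤ W → ∣ Z ∣ ℕ.≤ W → ∣ x ∣ ℕ.≤ W ℕ.* (∣ p ∣ ℕ.+ ∣ q ∣)
      scaled-bound {W} D Y Z x p q D≢0 eq Y≤W Z≤W = begin
        ∣ x ∣                                  ≤⟨ ℕ.m≤n*m ∣ x ∣ ∣ D ∣ {{ℕ.≢-nonZero (D≢0 ∘ ℤ.∣i∣≡0⇒i≡0)}} ⟩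
        ∣ D ∣ ℕ.* ∣ x ∣                        ≡⟨ ℤ.abs-* D x ⟨
        ∣ D * x ∣                              ≡⟨ cong ∣_∣ eq ⟩
        ∣ Y * p - Z * q ∣                      ≤⟨ ℤ.∣i-j∣≤∣i∣+∣j∣ (Y * p) (Z * q) ⟩
        ∣ Y * p ∣ ℕ.+ ∣ Z * q ∣                ≡⟨ cong₂ ℕ._+_ (ℤ.abs-* Y p) (ℤ.abs-* Z q) ⟩
        ∣ Y ∣ ℕ.* ∣ p ∣ ℕ.+ ∣ Z ∣ ℕ.* ∣ q ∣    ≤⟨ ℕ.+-mono-≤ (ℕ.*-monoˡ-≤ ∣ p ∣ Y≤W) (ℕ.*-monoˡ-≤ ∣ q ∣ Z≤W) ⟩
        W ℕ.* ∣ p ∣ ℕ.+ W ℕ.* ∣ q ∣            ≡⟨ ℕ.*-distribˡ-+ W ∣ p ∣ ∣ q ∣ ⟨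
        W ℕ.* (∣ p ∣ ℕ.+ ∣ q ∣)                ∎
        where open ℕ.≤-Reasoning

      -- A normal is determined by its values on two independent differences `e`, `f` of points, and
      -- each value is at most the width. `R` adds the constants for the two coordinates, so that it
      -- serves both.
      coercive : ∃[ R ] ∀ g → Bounded (∣ width g ∣ ℕ.* R) g
      coercive = R , λ g → first g , second g
        where
        i = proj₁ noncollinear
        j = proj₁ (proj₂ noncollinear)
        k = proj₁ (proj₂ (proj₂ noncollinear))
        det≢0 = proj₂ (proj₂ (proj₂ noncollinear))
        e = u j ⊞ ⊟ u i
        f = u k ⊞ ⊟ u i
        R = (∣ proj₂ f ∣ ℕ.+ ∣ proj₂ e ∣) ℕ.+ (∣ proj₁ e ∣ ℕ.+ ∣ proj₁ f ∣)
        eq₁ : ∀ e₁ e₂ f₁ f₂ x y → (e₁ * f₂ - e₂ * f₁) * x ≡ (x * e₁ + y * e₂) * f₂ - (x * f₁ + y * f₂) * e₂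
        eq₁ = solve-∀
        eq₂ : ∀ e₁ e₂ f₁ f₂ x y → (e₁ * f₂ - e₂ * f₁) * y ≡ (x * f₁ + y * f₂) * e₁ - (x * e₁ + y * e₂) * f₁
        eq₂ = solve-∀
        first : ∀ g → ∣ proj₁ g ∣ ℕ.≤ ∣ width g ∣ ℕ.* R
        first g@(g₁ , g₂) = ℕ.≤-trans
          (scaled-bound (det e f) (g ∙ e) (g ∙ f) g₁ (proj₂ f) (proj₂ e) det≢0
            (eq₁ (proj₁ e) (proj₂ e) (proj₁ f) (proj₂ f) g₁ g₂) (spread-bound g i j) (spread-bound g i k))
          (ℕ.*-monoʳ-≤ ∣ width g ∣ (ℕ.m≤m+n (∣ proj₂ f ∣ ℕ.+ ∣ proj₂ e ∣) (∣ proj₁ e ∣ ℕ.+ ∣ proj₁ f ∣)))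
        second : ∀ g → ∣ proj₂ g ∣ ℕ.≤ ∣ width g ∣ ℕ.* R
        second g@(g₁ , g₂) = ℕ.≤-trans
          (scaled-bound (det e f) (g ∙ f) (g ∙ e) g₂ (proj₁ e) (proj₁ f) det≢0
            (eq₂ (proj₁ e) (proj₂ e) (proj₁ f) (proj₂ f) g₁ g₂) (spread-bound g i k) (spread-bound g i j))
          (ℕ.*-monoʳ-≤ ∣ width g ∣ (ℕ.m≤n+m (∣ proj₁ e ∣ ℕ.+ ∣ proj₁ f ∣) (∣ proj₂ f ∣ ℕ.+ ∣ proj₂ e ∣)))

      Bounded-mono : ∀ {A B} g → A ℕ.≤ B → Bounded A g → Bounded B g
      Bounded-mono _ A≤B (p , q) = ℕ.≤-trans p A≤B , ℕ.≤-trans q A≤B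

      abs-mono : ∀ {x y} → 0ℤ ≤ x → x ≤ y → ∣ x ∣ ℕ.≤ ∣ y ∣
      abs-mono (+≤+ _) (+≤+ x≤y) = x≤y

      M-coercive : ∀ {C} a b → M a b < C → Bounded (∣ C ∣ ℕ.* proj₁ coercive) a
      M-coercive a b M<C = Bounded-mono a
        (ℕ.*-monoˡ-≤ (proj₁ coercive) (abs-mono (width-nonNeg a) (ℤ.≤-trans (width≤M a b) (ℤ.<⇒≤ M<C))))
        (proj₂ coercive a)

      Better : ℤ² → ℤ² → ℤ² → ℤ² → Set
      Better a b a′ b′ = det a′ b′ ≢ 0ℤ × M a′ b′ < M a b

      better? : ∀ a b a′ b′ → Dec (Better a b a′ b′)
      better? a b a′ b′ = ¬? (det a′ b′ ℤ.≟ 0ℤ) ×-dec (M a′ b′ ℤ.<? M a b)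

      -- An improving pair has `M` below `M a b`, which bounds `a′` through its width, and `b′` by
      -- the symmetry of `M`.
      improve? : ∀ a b → Dec (∃[ a′ ] ∃[ b′ ] Better a b a′ b′)
      improve? a b = map′ to from
        (boundedAny²? (λ a′ → boundedAny²? (better? a b a′) B) B)
        where
        B = ∣ M a b ∣ ℕ.* proj₁ coercive
        to : (∃[ a′ ] Bounded B a′ × ∃[ b′ ] Bounded B b′ × Better a b a′ b′) → ∃[ a′ ] ∃[ b′ ] Better a b a′ b′
        to (a′ , _ , b′ , _ , better) = a′ , b′ , better
        from : (∃[ a′ ] ∃[ b′ ] Better a b a′ b′) → ∃[ a′ ] Bounded B a′ × ∃[ b′ ] Bounded B b′ × Better a b a′ b′
        from (a′ , b′ , better@(_ , M<)) = a′ , M-coercive a′ b′ M< ,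
          b′ , M-coercive b′ a′ (subst (_< M a b) (sym (M-swap a′ b′)) M<) , better

      -- Descent on the upper bound `n`: every improvement lowers the integer `M`, which is never
      -- negative.
      minimise : ∀ n a b → det a b ≢ 0ℤ → M a b < + n →
        ∃[ p ] ∃[ q ] det p q ≢ 0ℤ × (∀ a′ b′ → det a′ b′ ≢ 0ℤ → M p q ≤ M a′ b′)
      minimise ℕ.zero a b _ M<0 = contradiction M<0 (ℤ.≤⇒≯ (M-nonNeg a b))
      minimise (ℕ.suc n) a b det≢0 M<1+n = step (improve? a b)
        where
        step : Dec (∃[ a′ ] ∃[ b′ ] Better a b a′ b′) →
          ∃[ p ] ∃[ q ] det p q ≢ 0ℤ × (∀ a′ b′ → det a′ b′ ≢ 0ℤ → M p q ≤ M a′ b′)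
        step (yes (a′ , b′ , det′≢0 , M′<M)) = minimise n a′ b′ det′≢0 (ℤ.<-≤-trans M′<M (ℤ.i<j⇒i≤pred[j] M<1+n))
        step (no ¬better) = a , b , det≢0 , λ a′ b′ det′≢0 → ℤ.≮⇒≥ (λ M′<M → ¬better (a′ , b′ , det′≢0 , M′<M))

      minimal : ∃[ a ] ∃[ b ] Minimal a b × Reduced a b
      minimal =
        let p , q , det≢0 , least = minimise (ℕ.suc ∣ M e₁ e₂ ∣) e₁ e₂ (λ ()) (<1+∣∣ (M-nonNeg e₁ e₂))
            a , b , ∣det∣≡1 , M≤ = unimodularise ∣ det p q ∣ p q det≢0 ℕ.≤-refl
        in sort {a} {b} (∣det∣≡1 , λ a′ b′ det′≢0 → ℤ.≤-trans M≤ (least a′ b′ det′≢0))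
        where
        <1+∣∣ : ∀ {i} → 0ℤ ≤ i → i < + ℕ.suc ∣ i ∣
        <1+∣∣ (+≤+ _) = +<+ (ℕ.n<1+n _)

  -- Unimodular matrices and their minors.

  ∣i∣≡1⇒i*i≡1 : ∀ i → ∣ i ∣ ≡ 1 → i * i ≡ 1ℤ
  ∣i∣≡1⇒i*i≡1 (+ 1) refl = refl
  ∣i∣≡1⇒i*i≡1 -[1+ 0 ] refl = refl

  vec : ℤ² → Vector ℤ 2
  vec (a , b) = a ∷ b ∷ []

  rows : ℤ² → ℤ² → Matrix 2
  rows p q = vec p ∷ vec q ∷ []

  -- The rows of the map (x, y) ↦ (x, g · (y + xτ), …).
  lift : ℤ² → ℤ² → Vector ℤ 3
  lift τ g = (g ∙ τ) ∷ vec g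

  shear : ℤ² → ℤ² → ℤ² → Matrix 3
  shear τ p q = (1ℤ ∷ 0ℤ ∷ 0ℤ ∷ []) ∷ lift τ p ∷ lift τ q ∷ []

  -- The inverse is the adjugate times `D`, since multiplying by `D` is dividing by `D` when `D` is
  -- a unit.
  rows-invertible : ∀ p q → ∣ det p q ∣ ≡ 1 → Invertible (rows p q)
  rows-invertible p@(p₁ , p₂) q@(q₁ , q₂) ∣det∣≡1 = B ,
    (λ { 0F 0F → trans (e₁ p₁ p₂ q₁ q₂ D) DD≡1 ; 0F 1F → e₂ p₁ p₂ D
       ; 1F 0F → e₃ q₁ q₂ D ; 1F 1F → trans (e₄ p₁ p₂ q₁ q₂ D) DD≡1 }) ,
    (λ { 0F 0F → trans (f₁ p₁ p₂ q₁ q₂ D) DD≡1 ; 0F 1F → f₂ p₂ q₂ D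
       ; 1F 0F → f₃ p₁ q₁ D ; 1F 1F → trans (f₄ p₁ p₂ q₁ q₂ D) DD≡1 })
    where
    D = det p q
    DD≡1 = ∣i∣≡1⇒i*i≡1 D ∣det∣≡1
    B = rows (D * q₂ , - (D * p₂)) (- (D * q₁) , D * p₁)
    e₁ : ∀ p₁ p₂ q₁ q₂ D → p₁ * (D * q₂) + (p₂ * - (D * q₁) + 0ℤ) ≡ D * (p₁ * q₂ - p₂ * q₁)
    e₁ = solve-∀
    e₂ : ∀ p₁ p₂ D → p₁ * - (D * p₂) + (p₂ * (D * p₁) + 0ℤ) ≡ 0ℤ
    e₂ = solve-∀
    e₃ : ∀ q₁ q₂ D → q₁ * (D * q₂) + (q₂ * - (D * q₁) + 0ℤ) ≡ 0ℤ
    e₃ = solve-∀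
    e₄ : ∀ p₁ p₂ q₁ q₂ D → q₁ * - (D * p₂) + (q₂ * (D * p₁) + 0ℤ) ≡ D * (p₁ * q₂ - p₂ * q₁)
    e₄ = solve-∀
    f₁ : ∀ p₁ p₂ q₁ q₂ D → D * q₂ * p₁ + (- (D * p₂) * q₁ + 0ℤ) ≡ D * (p₁ * q₂ - p₂ * q₁)
    f₁ = solve-∀
    f₂ : ∀ p₂ q₂ D → D * q₂ * p₂ + (- (D * p₂) * q₂ + 0ℤ) ≡ 0ℤ
    f₂ = solve-∀
    f₃ : ∀ p₁ q₁ D → - (D * q₁) * p₁ + (D * p₁ * q₁ + 0ℤ) ≡ 0ℤ
    f₃ = solve-∀
    f₄ : ∀ p₁ p₂ q₁ q₂ D → - (D * q₁) * p₂ + (D * p₁ * q₂ + 0ℤ) ≡ D * (p₁ * q₂ - p₂ * q₁)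
    f₄ = solve-∀

  shear-invertible : ∀ τ p q → ∣ det p q ∣ ≡ 1 → Invertible (shear τ p q)
  shear-invertible τ@(t₁ , t₂) p@(p₁ , p₂) q@(q₁ , q₂) ∣det∣≡1 = B ,
    (λ { 0F 0F → refl ; 0F 1F → refl ; 0F 2F → refl
       ; 1F 0F → e₀ p₁ p₂ t₁ t₂
       ; 1F 1F → trans (e₁ p₁ p₂ q₁ q₂ t₁ t₂ D) DD≡1 ; 1F 2F → e₂ p₁ p₂ t₁ t₂ D
       ; 2F 0F → e₀ q₁ q₂ t₁ t₂
       ; 2F 1F → e₃ q₁ q₂ t₁ t₂ D ; 2F 2F → trans (e₄ p₁ p₂ q₁ q₂ t₁ t₂ D) DD≡1 }) ,
    (λ { 0F 0F → refl ; 0F 1F → refl ; 0F 2F → refl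
       ; 1F 0F → trans (g₁ p₁ p₂ q₁ q₂ t₁ t₂ D) (cancel t₁)
       ; 1F 1F → trans (f₁ p₁ p₂ q₁ q₂ t₁ D) DD≡1 ; 1F 2F → f₂ p₂ q₂ t₁ D
       ; 2F 0F → trans (g₂ p₁ p₂ q₁ q₂ t₁ t₂ D) (cancel t₂)
       ; 2F 1F → f₃ p₁ q₁ t₂ D ; 2F 2F → trans (f₄ p₁ p₂ q₁ q₂ t₂ D) DD≡1 })
    where
    D = det p q
    DD≡1 = ∣i∣≡1⇒i*i≡1 D ∣det∣≡1
    -- The lower right block inverts `rows p q`, and the column `- τ` undoes the shear.
    B : Matrix 3
    B = (1ℤ ∷ 0ℤ ∷ 0ℤ ∷ []) ∷ (- t₁ ∷ D * q₂ ∷ - (D * p₂) ∷ []) ∷ (- t₂ ∷ - (D * q₁) ∷ D * p₁ ∷ []) ∷ []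
    e₀ : ∀ p₁ p₂ t₁ t₂ → (p₁ * t₁ + p₂ * t₂) * 1ℤ + (p₁ * - t₁ + (p₂ * - t₂ + 0ℤ)) ≡ 0ℤ
    e₀ = solve-∀
    e₁ : ∀ p₁ p₂ q₁ q₂ t₁ t₂ D → (p₁ * t₁ + p₂ * t₂) * 0ℤ + (p₁ * (D * q₂) + (p₂ * - (D * q₁) + 0ℤ)) ≡ D * (p₁ * q₂ - p₂ * q₁)
    e₁ = solve-∀
    e₂ : ∀ p₁ p₂ t₁ t₂ D → (p₁ * t₁ + p₂ * t₂) * 0ℤ + (p₁ * - (D * p₂) + (p₂ * (D * p₁) + 0ℤ)) ≡ 0ℤ
    e₂ = solve-∀
    e₃ : ∀ q₁ q₂ t₁ t₂ D → (q₁ * t₁ + q₂ * t₂) * 0ℤ + (q₁ * (D * q₂) + (q₂ * - (D * q₁) + 0ℤ)) ≡ 0ℤ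
    e₃ = solve-∀
    e₄ : ∀ p₁ p₂ q₁ q₂ t₁ t₂ D → (q₁ * t₁ + q₂ * t₂) * 0ℤ + (q₁ * - (D * p₂) + (q₂ * (D * p₁) + 0ℤ)) ≡ D * (p₁ * q₂ - p₂ * q₁)
    e₄ = solve-∀
    g₁ : ∀ p₁ p₂ q₁ q₂ t₁ t₂ D → - t₁ * 1ℤ + (D * q₂ * (p₁ * t₁ + p₂ * t₂) + (- (D * p₂) * (q₁ * t₁ + q₂ * t₂) + 0ℤ)) ≡
      - t₁ + D * (p₁ * q₂ - p₂ * q₁) * t₁
    g₁ = solve-∀
    g₂ : ∀ p₁ p₂ q₁ q₂ t₁ t₂ D → - t₂ * 1ℤ + (- (D * q₁) * (p₁ * t₁ + p₂ * t₂) + (D * p₁ * (q₁ * t₁ + q₂ * t₂) + 0ℤ)) ≡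
      - t₂ + D * (p₁ * q₂ - p₂ * q₁) * t₂
    g₂ = solve-∀
    cancel : ∀ t → - t + D * D * t ≡ 0ℤ
    cancel t = trans (cong (λ d → - t + d * t) DD≡1) (trans (cong (λ s → - t + s) (ℤ.*-identityˡ t)) (ℤ.+-inverseˡ t))
    f₁ : ∀ p₁ p₂ q₁ q₂ t D → - t * 0ℤ + (D * q₂ * p₁ + (- (D * p₂) * q₁ + 0ℤ)) ≡ D * (p₁ * q₂ - p₂ * q₁)
    f₁ = solve-∀
    f₂ : ∀ p₂ q₂ t D → - t * 0ℤ + (D * q₂ * p₂ + (- (D * p₂) * q₂ + 0ℤ)) ≡ 0ℤ
    f₂ = solve-∀
    f₃ : ∀ p₁ q₁ t D → - t * 0ℤ + (- (D * q₁) * p₁ + (D * p₁ * q₁ + 0ℤ)) ≡ 0ℤ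
    f₃ = solve-∀
    f₄ : ∀ p₁ p₂ q₁ q₂ t D → - t * 0ℤ + (- (D * q₁) * p₂ + (D * p₁ * q₂ + 0ℤ)) ≡ D * (p₁ * q₂ - p₂ * q₁)
    f₄ = solve-∀

  row² : Vector ℤ 2 → ℤ²
  row² g = g 0F , g 1F

  tail² : Vector ℤ 3 → ℤ²
  tail² g = g 1F , g 2F

  invertible⇒det≢0 : ∀ {A} → Invertible A → det (row² (A 0F)) (row² (A 1F)) ≢ 0ℤ
  invertible⇒det≢0 {A} (B , _ , BA≡I) det≡0 = contradiction 1≡0 λ ()
    where
    open ≡-Reasoning
    eq : ∀ a b c d x y z w →
      (a * x + (b * y + 0ℤ)) * (c * z + (d * w + 0ℤ)) - (a * z + (b * w + 0ℤ)) * (c * x + (d * y + 0ℤ)) ≡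
      (a * d - b * c) * (x * w - z * y)
    eq = solve-∀
    1≡0 : 1ℤ ≡ 0ℤ
    1≡0 = begin
      1ℤ * 1ℤ - 0ℤ * 0ℤ            ≡⟨ cong₂ _-_ (cong₂ _*_ (BA≡I 0F 0F) (BA≡I 1F 1F)) (cong₂ _*_ (BA≡I 0F 1F) (BA≡I 1F 0F)) ⟨
      (B · A) 0F 0F * (B · A) 1F 1F - (B · A) 0F 1F * (B · A) 1F 0F
                                   ≡⟨ eq (B 0F 0F) (B 0F 1F) (B 1F 0F) (B 1F 1F) (A 0F 0F) (A 1F 0F) (A 0F 1F) (A 1F 1F) ⟩
      det (row² (B 0F)) (row² (B 1F)) * det (row² (A 0F)) (row² (A 1F))
                                   ≡⟨ cong (det (row² (B 0F)) (row² (B 1F)) *_) det≡0 ⟩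
      det (row² (B 0F)) (row² (B 1F)) * 0ℤ
                                   ≡⟨ ℤ.*-zeroʳ (det (row² (B 0F)) (row² (B 1F))) ⟩
      0ℤ                           ∎

  -- The tails of the rows are, up to sign, the normals induced on `P₀`. Two of them must be
  -- independent for `merge` to apply.
  Nondegenerate : Matrix 3 → Set
  Nondegenerate A = det (minor 0F) (minor 1F) ≢ 0ℤ ⊎ det (minor 1F) (minor 2F) ≢ 0ℤ ⊎ det (minor 2F) (minor 0F) ≢ 0ℤ
    where
    minor : Fin 3 → ℤ²
    minor i = tail² (A i)

  -- Cauchy–Binet for two rows of B and two columns of A.
  invertible⇒nondegenerate : ∀ {A} → Invertible A → Nondegenerate A
  invertible⇒nondegenerate {A} (B , _ , BA≡I) = cases (A′ 0F 1F ℤ.≟ 0ℤ) (A′ 1F 2F ℤ.≟ 0ℤ) (A′ 2F 0F ℤ.≟ 0ℤ)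
    where
    A′ B′ : Fin 3 → Fin 3 → ℤ
    A′ i j = det (tail² (A i)) (tail² (A j))
    B′ i j = B 1F i * B 2F j - B 1F j * B 2F i
    eq : ∀ a b c a′ b′ c′ x y z x′ y′ z′ →
      (a * x + (b * y + (c * z + 0ℤ))) * (a′ * x′ + (b′ * y′ + (c′ * z′ + 0ℤ))) -
      (a * x′ + (b * y′ + (c * z′ + 0ℤ))) * (a′ * x + (b′ * y + (c′ * z + 0ℤ))) ≡
      (a * b′ - b * a′) * (x * y′ - x′ * y) + (b * c′ - c * b′) * (y * z′ - y′ * z) +
      (c * a′ - a * c′) * (z * x′ - z′ * x)
    eq = solve-∀
    cauchy-binet : 1ℤ ≡ B′ 0F 1F * A′ 0F 1F + B′ 1F 2F * A′ 1F 2F + B′ 2F 0F * A′ 2F 0F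
    cauchy-binet = trans
      (sym (cong₂ _-_ (cong₂ _*_ (BA≡I 1F 1F) (BA≡I 2F 2F)) (cong₂ _*_ (BA≡I 1F 2F) (BA≡I 2F 1F))))
      (eq (B 1F 0F) (B 1F 1F) (B 1F 2F) (B 2F 0F) (B 2F 1F) (B 2F 2F)
        (A 0F 1F) (A 1F 1F) (A 2F 1F) (A 0F 2F) (A 1F 2F) (A 2F 2F))
    zeros : ∀ x y z → x * 0ℤ + y * 0ℤ + z * 0ℤ ≡ 0ℤ
    zeros = solve-∀
    cases : Dec (A′ 0F 1F ≡ 0ℤ) → Dec (A′ 1F 2F ≡ 0ℤ) → Dec (A′ 2F 0F ≡ 0ℤ) → Nondegenerate A
    cases (no ≢0) _ _ = inj₁ ≢0
    cases _ (no ≢0) _ = inj₂ (inj₁ ≢0)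
    cases _ _ (no ≢0) = inj₂ (inj₂ ≢0)
    cases (yes p) (yes q) (yes r) = contradiction
      (trans cauchy-binet (trans (cong₂ _+_ (cong₂ _+_ (cong (B′ 0F 1F *_) p) (cong (B′ 1F 2F *_) q)) (cong (B′ 2F 0F *_) r))
        (zeros (B′ 0F 1F) (B′ 1F 2F) (B′ 2F 0F)))) λ ()

open PlanarLattice

-- Finite sums.

module SumProperties {c ℓ} (R : CommutativeSemiring c ℓ) where
  open CommutativeSemiring R
  open Algebra.Properties.Semiring.Sum semiring
  open import Relation.Binary.Reasoning.Setoid setoid

  sum-*-assoc : ∀ {m n} (a : Vector Carrier m) (B : Vector (Vector Carrier n) m) (x : Vector Carrier n) →
    sum (λ j → sum (λ i → a i * B i j) * x j) ≈ sum (λ i → a i * sum (λ j → B i j * x j))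
  sum-*-assoc a B x = begin
    sum (λ j → sum (λ i → a i * B i j) * x j)     ≈⟨ sum-cong-≋ (λ j → *-distribʳ-sum (x j) (λ i → a i * B i j)) ⟩
    sum (λ j → sum (λ i → a i * B i j * x j))     ≈⟨ ∑-comm (λ j i → a i * B i j * x j) ⟩
    sum (λ i → sum (λ j → a i * B i j * x j))     ≈⟨ sum-cong-≋ (λ i → sum-cong-≋ (λ j → *-assoc (a i) (B i j) (x j))) ⟩
    sum (λ i → sum (λ j → a i * (B i j * x j)))   ≈⟨ sum-cong-≋ (λ i → *-distribˡ-sum (a i) (λ j → B i j * x j)) ⟨
    sum (λ i → a i * sum (λ j → B i j * x j))     ∎

  sum-zeroˡ : ∀ {n} (f g : Vector Carrier n) → (∀ i → f i ≈ 0#) → sum (λ i → f i * g i) ≈ 0#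
  sum-zeroˡ {n} f g f≈0 = trans (sum-cong-≋ (λ i → trans (*-congʳ (f≈0 i)) (zeroˡ (g i)))) (sum-replicate-zero n)

  sum-single : ∀ {n} (f : Vector Carrier n) k → (∀ i → i ≢ k → f i ≈ 0#) → sum f ≈ f k
  sum-single {ℕ.suc n} f Fin.zero f≈0 = trans
    (+-congˡ (trans (sum-cong-≋ (λ i → f≈0 (Fin.suc i) λ ())) (sum-replicate-zero n)))
    (+-identityʳ (f Fin.zero))
  sum-single {ℕ.suc n} f (Fin.suc k) f≈0 = trans
    (+-cong (f≈0 Fin.zero λ ()) (sum-single (f ∘ Fin.suc) k (λ i i≢k → f≈0 (Fin.suc i) (i≢k ∘ Fin.suc-injective))))
    (+-identityˡ (f (Fin.suc k)))

-- Ordered fields and the embedding of ℤ.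

module OrderedFieldProperties {c ℓ₁ ℓ₂} (K : OrderedField c ℓ₁ ℓ₂) where
  open OrderedField K hiding (zero)
  open Geometry K
  open IsTotalOrder isTotalOrder public using (total; antisym; ≤-respˡ-≈; ≤-respʳ-≈)
    renaming (refl to ≤-refl; trans to ≤-trans; reflexive to ≤-reflexive)
  open Algebra.Properties.Ring ring public using (-‿involutive; -‿distribˡ-*; -‿distribʳ-*; -‿+-comm; -0#≈0#; -1*x≈-x)
  open Algebra.Properties.Semiring.Sum semiring public
    using (sum; sum-cong-≋; sum-replicate-zero; ∑-comm; ∑-distrib-+; *-distribˡ-sum; *-distribʳ-sum)
  open Algebra.Properties.Monoid.Mult +-monoid public using () renaming (_×_ to _times_; ×-homo-+ to times-homo-+)
  open SumProperties commutativeSemiring public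

  ≤-poset : Poset c ℓ₁ ℓ₂
  ≤-poset = record { isPartialOrder = IsTotalOrder.isPartialOrder isTotalOrder }

  module ≤-Reasoning = Relation.Binary.Reasoning.PartialOrder ≤-poset

  ≤-resp₂ : ∀ {x x′ y y′} → x ≈ x′ → y ≈ y′ → x ≤ y → x′ ≤ y′
  ≤-resp₂ x≈x′ y≈y′ = ≤-respˡ-≈ x≈x′ ∘ ≤-respʳ-≈ y≈y′

  +-monoˡ-≤ : ∀ x {y z} → y ≤ z → y + x ≤ z + x
  +-monoˡ-≤ x {y} {z} = ≤-resp₂ (+-comm x y) (+-comm x z) ∘ +-monoʳ-≤ x

  +-mono-≤ : ∀ {x y z w} → x ≤ y → z ≤ w → x + z ≤ y + w
  +-mono-≤ {y = y} {z} x≤y z≤w = ≤-trans (+-monoˡ-≤ z x≤y) (+-monoʳ-≤ y z≤w)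

  x+y-y≈x : ∀ x y → x + y - y ≈ x
  x+y-y≈x x y = trans (+-assoc x y (- y)) (trans (+-congˡ (-‿inverseʳ y)) (+-identityʳ x))

  x-y+y≈x : ∀ x y → x - y + y ≈ x
  x-y+y≈x x y = trans (+-assoc x (- y) y) (trans (+-congˡ (-‿inverseˡ y)) (+-identityʳ x))

  +-cancelʳ-≤ : ∀ z {x y} → x + z ≤ y + z → x ≤ y
  +-cancelʳ-≤ z {x} {y} = ≤-resp₂ (x+y-y≈x x z) (x+y-y≈x y z) ∘ +-monoˡ-≤ (- z)

  ≤⇒0≤- : ∀ {x y} → x ≤ y → 0# ≤ y - x
  ≤⇒0≤- {x} {y} x≤y = +-cancelʳ-≤ x (≤-resp₂ (sym (+-identityˡ x)) (sym (x-y+y≈x y x)) x≤y)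

  0≤-⇒≤ : ∀ {x y} → 0# ≤ y - x → x ≤ y
  0≤-⇒≤ {x} {y} = ≤-resp₂ (+-identityˡ x) (x-y+y≈x y x) ∘ +-monoˡ-≤ x

  neg-antimono-≤ : ∀ {x y} → x ≤ y → - y ≤ - x
  neg-antimono-≤ {x} {y} x≤y = 0≤-⇒≤ (≤-respʳ-≈ (trans (+-comm y (- x)) (+-congˡ (sym (-‿involutive y)))) (≤⇒0≤- x≤y))

  *-monoʳ-≤ : ∀ {k x y} → 0# ≤ k → x ≤ y → k * x ≤ k * y
  *-monoʳ-≤ {k} {x} {y} 0≤k x≤y = 0≤-⇒≤ (≤-respʳ-≈
    (trans (distribˡ k y (- x)) (+-congˡ (sym (-‿distribʳ-* k x)))) (*-nonneg 0≤k (≤⇒0≤- x≤y)))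

  0≤1 : 0# ≤ 1#
  0≤1 = [ (λ 0≤1 → 0≤1) , (λ 1≤0 → let 0≤-1 = ≤-respˡ-≈ -0#≈0# (neg-antimono-≤ 1≤0) in
    ≤-respʳ-≈ (trans (-1*x≈-x (- 1#)) (-‿involutive 1#)) (*-nonneg 0≤-1 0≤-1)) ]′ (total 0# 1#)

  1≰0 : ¬ (1# ≤ 0#)
  1≰0 1≤0 = 1≉0 (antisym 1≤0 0≤1)

  times-nonneg : ∀ n → 0# ≤ n times 1#
  times-nonneg ℕ.zero = ≤-refl
  times-nonneg (ℕ.suc n) = ≤-respˡ-≈ (+-identityˡ 0#) (+-mono-≤ 0≤1 (times-nonneg n))

  ι-neg : ∀ i → ι (ℤ.- i) ≈ - ι i
  ι-neg (+ ℕ.zero) = sym -0#≈0#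
  ι-neg +[1+ n ] = refl
  ι-neg -[1+ n ] = sym (-‿involutive _)

  ι-⊖ : ∀ m n → ι (m ℤ.⊖ n) ≈ m times 1# - n times 1#
  ι-⊖ m ℕ.zero = sym (trans (+-congˡ -0#≈0#) (+-identityʳ _))
  ι-⊖ ℕ.zero (ℕ.suc n) = sym (+-identityˡ _)
  ι-⊖ (ℕ.suc m) (ℕ.suc n) = trans (reflexive (≡.cong ι (ℤ.[1+m]⊖[1+n]≡m⊖n m n))) (trans (ι-⊖ m n) (sym cancel))
    where
    a = m times 1#
    b = n times 1#
    open import Relation.Binary.Reasoning.Setoid setoid
    cancel : (1# + a) - (1# + b) ≈ a - b
    cancel = begin
      (1# + a) - (1# + b)        ≈⟨ +-cong (+-comm 1# a) (sym (-‿+-comm 1# b)) ⟩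
      (a + 1#) + (- 1# + - b)    ≈⟨ +-assoc (a + 1#) (- 1#) (- b) ⟨
      (a + 1# - 1#) + - b        ≈⟨ +-congʳ (x+y-y≈x a 1#) ⟩
      a - b                      ∎

  ι-+ : ∀ i j → ι (i ℤ.+ j) ≈ ι i + ι j
  ι-+ (+ m) (+ n) = times-homo-+ 1# m n
  ι-+ (+ m) -[1+ n ] = ι-⊖ m (ℕ.suc n)
  ι-+ -[1+ m ] (+ n) = trans (ι-⊖ n (ℕ.suc m)) (+-comm _ _)
  ι-+ -[1+ m ] -[1+ n ] = trans (-‿cong (trans (reflexive (≡.cong (λ k → ℕ.suc k times 1#) (≡.sym (ℕ.+-suc m n))))
    (times-homo-+ 1# (ℕ.suc m) (ℕ.suc n)))) (sym (-‿+-comm _ _))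

  ι-1 : ι 1ℤ ≈ 1#
  ι-1 = +-identityʳ 1#

  ι-*-ℕ : ∀ i n → ι (i ℤ.* + n) ≈ ι i * ι (+ n)
  ι-*-ℕ i ℕ.zero = trans (reflexive (≡.cong ι (ℤ.*-zeroʳ i))) (sym (zeroʳ (ι i)))
  ι-*-ℕ i (ℕ.suc n) = begin
    ι (i ℤ.* + ℕ.suc n)            ≡⟨ ≡.cong ι (ℤ.*-suc i (+ n)) ⟩
    ι (i ℤ.+ i ℤ.* + n)            ≈⟨ ι-+ i (i ℤ.* + n) ⟩
    ι i + ι (i ℤ.* + n)            ≈⟨ +-cong (sym (*-identityʳ (ι i))) (ι-*-ℕ i n) ⟩
    ι i * 1# + ι i * ι (+ n)       ≈⟨ distribˡ (ι i) 1# (ι (+ n)) ⟨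
    ι i * ι (+ ℕ.suc n)            ∎
    where open import Relation.Binary.Reasoning.Setoid setoid

  ι-* : ∀ i j → ι (i ℤ.* j) ≈ ι i * ι j
  ι-* i (+ n) = ι-*-ℕ i n
  ι-* i j@(-[1+ n ]) = begin
    ι (i ℤ.* j)                    ≡⟨ ≡.cong ι (ℤ.neg-distribʳ-* i +[1+ n ]) ⟨
    ι (ℤ.- (i ℤ.* +[1+ n ]))       ≈⟨ ι-neg (i ℤ.* +[1+ n ]) ⟩
    - ι (i ℤ.* +[1+ n ])           ≈⟨ -‿cong (ι-*-ℕ i (ℕ.suc n)) ⟩
    - (ι i * ι +[1+ n ])           ≈⟨ -‿distribʳ-* (ι i) (ι +[1+ n ]) ⟩
    ι i * ι j                      ∎
    where open import Relation.Binary.Reasoning.Setoid setoid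

  ι-nonneg : ∀ {i} → 0ℤ ℤ.≤ i → 0# ≤ ι i
  ι-nonneg {+ n} _ = times-nonneg n

  ι-mono : ∀ {i j} → i ℤ.≤ j → ι i ≤ ι j
  ι-mono {i} {j} i≤j = 0≤-⇒≤ (≤-respʳ-≈ (trans (ι-+ j (ℤ.- i)) (+-congˡ (ι-neg i))) (ι-nonneg (ℤ.i≤j⇒0≤j-i i≤j)))

  ι-suc≰ : ∀ i → ¬ (ι (1ℤ ℤ.+ i) ≤ ι i)
  ι-suc≰ i h = 1≰0 (+-cancelʳ-≤ (ι i) (≤-resp₂ (trans (ι-+ 1ℤ i) (+-congʳ ι-1)) (sym (+-identityˡ (ι i))) h))

  -- If `i ≤ j` fails then `1 + j ≤ i`, whose image in `K` would give `1# ≤ 0#`. Bounds obtained in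
  -- `K` return to ℤ by this lemma.
  ι-cancel-≤ : ∀ {i j} → ι i ≤ ι j → i ℤ.≤ j
  ι-cancel-≤ {i} {j} ιi≤ιj with i ℤ.≤? j
  ... | yes i≤j = i≤j
  ... | no i≰j = contradiction (≤-trans (ι-mono (ℤ.i<j⇒suc[i]≤j (ℤ.≰⇒> i≰j))) ιi≤ιj) (ι-suc≰ j)

  ι-∑ : ∀ {n} (f : Vector ℤ n) → ι (∑ℤ f) ≈ sum (λ i → ι (f i))
  ι-∑ {ℕ.zero} f = refl
  ι-∑ {ℕ.suc n} f = trans (ι-+ (f zero) (∑ℤ (f ∘ suc))) (+-congˡ (ι-∑ (f ∘ suc)))

  sum-mono : ∀ {n} {f g : Vector Carrier n} → (∀ i → f i ≤ g i) → sum f ≤ sum g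
  sum-mono {ℕ.zero} f≤g = ≤-refl
  sum-mono {ℕ.suc n} f≤g = +-mono-≤ (f≤g zero) (sum-mono (f≤g ∘ suc))

  sum-nonneg : ∀ {n} {f : Vector Carrier n} → (∀ i → 0# ≤ f i) → 0# ≤ sum f
  sum-nonneg {n} {f} 0≤f = ≤-respˡ-≈ (sum-replicate-zero n) (sum-mono 0≤f)

  ι-inverse : ∀ {i} → 1ℤ ℤ.≤ i → ∃[ k ] 0# ≤ k × ι i * k ≈ 1#
  ι-inverse {i} 1≤i with inverse (ι i) (λ ιi≈0 → 1≰0 (≤-resp₂ ι-1 ιi≈0 (ι-mono 1≤i)))
  ... | k , ιi*k≈1 = k , [ (λ 0≤k → 0≤k) , (λ k≤0 → contradiction
    (≤-resp₂ ιi*k≈1 (zeroʳ (ι i)) (*-monoʳ-≤ (ι-nonneg (ℤ.≤-trans (+≤+ ℕ.z≤n) 1≤i)) k≤0)) 1≰0) ]′ (total 0# k) , ιi*k≈1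

-- Integer matrices and bases of the lattice.

diagonal-diagonal : ∀ {d} (s : Vector ℤ d) k → diagonal s k k ≡ s k
diagonal-diagonal s k = ≡.cong (if_then s k else 0ℤ) (dec-true (k Fin.≟ k) ≡.refl)

diagonal-off : ∀ {d} (s : Vector ℤ d) {i k} → i ≢ k → diagonal s i k ≡ 0ℤ
diagonal-off s {i} {k} i≢k = ≡.cong (if_then s i else 0ℤ) (dec-false (i Fin.≟ k) i≢k)

identity-diagonal : ∀ {d} (k : Fin d) → identity k k ≡ 1ℤ
identity-diagonal = diagonal-diagonal (λ _ → 1ℤ)

identity-off : ∀ {d} {i k : Fin d} → i ≢ k → identity i k ≡ 0ℤ
identity-off = diagonal-off (λ _ → 1ℤ)

module ℤ-Sum = SumProperties ℤ.+-*-commutativeSemiring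

∑ℤ-cong : ∀ {n} {f g : Vector ℤ n} → (∀ i → f i ≡ g i) → ∑ℤ f ≡ ∑ℤ g
∑ℤ-cong {ℕ.zero} _ = ≡.refl
∑ℤ-cong {ℕ.suc n} f≗g = ≡.cong₂ ℤ._+_ (f≗g zero) (∑ℤ-cong (f≗g ∘ suc))

combination-congʳ : ∀ {d} (a : Vector ℤ d) {h h′ : Matrix d} → (∀ i j → h i j ≡ h′ i j) →
  ∀ j → combination a h j ≡ combination a h′ j
combination-congʳ a h≗h′ j = ∑ℤ-cong (λ i → ≡.cong (a i ℤ.*_) (h≗h′ i j))

combination-assoc : ∀ {d} (a : Vector ℤ d) (B h : Matrix d) j →
  combination (combination a B) h j ≡ combination a (B · h) j
combination-assoc a B h j = ℤ-Sum.sum-*-assoc a B (λ i → h i j)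

combination-identity : ∀ {d} (a : Vector ℤ d) j → combination a identity j ≡ a j
combination-identity a j = ≡.trans
  (ℤ-Sum.sum-single (λ i → a i ℤ.* identity i j) j
    (λ i i≢j → ≡.trans (≡.cong (a i ℤ.*_) (identity-off i≢j)) (ℤ.*-zeroʳ (a i))))
  (≡.trans (≡.cong (a j ℤ.*_) (identity-diagonal j)) (ℤ.*-identityʳ (a j)))

diagonal-· : ∀ {d} (s : Vector ℤ d) (h : Matrix d) i j → combination (diagonal s i) h j ≡ s i ℤ.* h i j
diagonal-· s h i j = ≡.trans
  (ℤ-Sum.sum-single (λ k → diagonal s i k ℤ.* h k j) i
    (λ k k≢i → ≡.cong (ℤ._* h k j) (diagonal-off s (k≢i ∘ ≡.sym))))
  (≡.cong (ℤ._* h i j) (diagonal-diagonal s i))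

-- Coordinates with respect to the rows of `h` are found by multiplying with `B` on the right:
-- `B · h` gives spanning and `h · B` independence.
invertible⇒basis : ∀ {d} {h : Matrix d} → Invertible h → IsBasis h
invertible⇒basis {h = h} (B , hB≡I , Bh≡I) =
  (λ z → combination z B , λ j → ≡.trans (combination-assoc z B h j)
    (≡.trans (combination-congʳ z Bh≡I j) (combination-identity z j))) ,
  λ a ah≡0 i → ≡.trans (≡.sym (combination-identity a i)) (≡.trans (≡.sym (combination-congʳ a hB≡I i))
    (≡.trans (≡.sym (combination-assoc a h B i))
      (ℤ-Sum.sum-zeroˡ (combination a h) (λ k → B k i) ah≡0)))

infix 8 ⊝_
⊝_ : ∀ {d} → Vector ℤ d → Vector ℤ d
(⊝ g) i = ℤ.- g i

dot : ∀ {d} → Vector ℤ d → Vector ℤ d → ℤ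
dot g z = ∑ℤ (λ i → g i ℤ.* z i)

columnSum : ∀ {d} → Matrix d → Vector ℤ d
columnSum A j = ∑ℤ (λ i → A i j)

-- Convex hulls and dilated simplices.

module ConvexProperties {c ℓ₁ ℓ₂} (K : OrderedField c ℓ₁ ℓ₂) where
  open OrderedField K hiding (zero)
  open Geometry K
  open OrderedFieldProperties K
  ⟨⟩-congʳ : ∀ {d} (g : Vector ℤ d) {x y : Point d} → x ≋ y → ⟨ g , x ⟩ ≈ ⟨ g , y ⟩
  ⟨⟩-congʳ g x≋y = sum-cong-≋ (λ i → *-congˡ (x≋y i))

  ⟨⟩-congˡ : ∀ {d} {g h : Vector ℤ d} (x : Point d) → (∀ i → g i ≡ h i) → ⟨ g , x ⟩ ≈ ⟨ h , x ⟩
  ⟨⟩-congˡ x g≗h = sum-cong-≋ (λ i → *-congʳ (reflexive (≡.cong ι (g≗h i))))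

  ⟨⟩-lattice : ∀ {d} (g z : Vector ℤ d) → ⟨ g , lattice z ⟩ ≈ ι (dot g z)
  ⟨⟩-lattice g z = sym (trans (ι-∑ (λ i → g i ℤ.* z i)) (sum-cong-≋ (λ i → ι-* (g i) (z i))))

  ⟨⟩-combination : ∀ {d} (a : Vector ℤ d) (h : Matrix d) (x : Point d) →
    ⟨ combination a h , x ⟩ ≈ ⟨ a , linear h x ⟩
  ⟨⟩-combination a h x = trans
    (sum-cong-≋ (λ j → *-congʳ (trans (ι-∑ (λ i → a i ℤ.* h i j)) (sum-cong-≋ (λ i → ι-* (a i) (h i j))))))
    (sum-*-assoc (λ i → ι (a i)) (λ i j → ι (h i j)) x)

  ⟨⟩-⊝ : ∀ {d} (g : Vector ℤ d) (x : Point d) → ⟨ ⊝ g , x ⟩ ≈ - ⟨ g , x ⟩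
  ⟨⟩-⊝ {ℕ.zero} g x = sym -0#≈0#
  ⟨⟩-⊝ {ℕ.suc d} g x = trans
    (+-cong (trans (*-congʳ (ι-neg (g zero))) (sym (-‿distribˡ-* _ _))) (⟨⟩-⊝ (g ∘ suc) (x ∘ suc)))
    (-‿+-comm _ _)

  ⟨⟩-+ : ∀ {d} (g : Vector ℤ d) (x y : Point d) → ⟨ g , (λ i → x i + y i) ⟩ ≈ ⟨ g , x ⟩ + ⟨ g , y ⟩
  ⟨⟩-+ g x y = trans (sum-cong-≋ (λ i → distribˡ (ι (g i)) (x i) (y i)))
    (∑-distrib-+ (λ i → ι (g i) * x i) (λ i → ι (g i) * y i))

  ⟨⟩-* : ∀ {d} (g : Vector ℤ d) k (x : Point d) → ⟨ g , (λ i → k * x i) ⟩ ≈ k * ⟨ g , x ⟩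
  ⟨⟩-* g k x = trans
    (sum-cong-≋ (λ i → trans (sym (*-assoc (ι (g i)) k (x i))) (trans (*-congʳ (*-comm (ι (g i)) k)) (*-assoc k (ι (g i)) (x i)))))
    (sym (*-distribˡ-sum k (λ i → ι (g i) * x i)))

  ⟨⟩-columnSum : ∀ {d} (A : Matrix d) (x : Point d) → ⟨ columnSum A , x ⟩ ≈ sum (linear A x)
  ⟨⟩-columnSum A x = trans
    (sum-cong-≋ (λ j → trans (*-congʳ (ι-∑ (λ i → A i j))) (*-distribʳ-sum (x j) (λ i → ι (A i j)))))
    (∑-comm (λ j i → ι (A i j) * x j))

  conv-⟨⟩≤ : ∀ {d s} {S : Pred (Point d) s} (g : Vector ℤ d) M →
    (∀ x → x ∈ S → ⟨ g , x ⟩ ≤ M) → ∀ {x} → x ∈ conv S → ⟨ g , x ⟩ ≤ M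
  conv-⟨⟩≤ g M S≤M {x} (n , a , v , v∈S , 0≤a , ∑a≈1 , av≈x) = begin
    ⟨ g , x ⟩                                         ≈⟨ sum-cong-≋ (λ j → trans (*-congˡ (sym (av≈x j))) (*-comm _ _)) ⟩
    sum (λ j → sum (λ i → a i * v i j) * ι (g j))     ≈⟨ sum-*-assoc a v (λ j → ι (g j)) ⟩
    sum (λ i → a i * sum (λ j → v i j * ι (g j)))     ≈⟨ sum-cong-≋ (λ i → *-congˡ {a i} (sum-cong-≋ (λ j → *-comm (v i j) (ι (g j))))) ⟩
    sum (λ i → a i * ⟨ g , v i ⟩)                     ≤⟨ sum-mono (λ i → *-monoʳ-≤ (0≤a i) (S≤M (v i) (v∈S i))) ⟩
    sum (λ i → a i * M)                               ≈⟨ *-distribʳ-sum M a ⟨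
    sum a * M                                         ≈⟨ *-congʳ ∑a≈1 ⟩
    1# * M                                            ≈⟨ *-identityˡ M ⟩
    M                                                 ∎
    where open ≤-Reasoning

  conv-resp-≋ : ∀ {d s} {S : Pred (Point d) s} {x y} → x ≋ y → x ∈ conv S → y ∈ conv S
  conv-resp-≋ x≋y (n , a , v , v∈S , 0≤a , ∑a≈1 , av≈x) = n , a , v , v∈S , 0≤a , ∑a≈1 , λ j → trans (av≈x j) (x≋y j)

  ⊆conv : ∀ {d s} {S : Pred (Point d) s} {x} → x ∈ S → x ∈ conv S
  ⊆conv {x = x} x∈S = 1 , (λ _ → 1#) , (λ _ → x) , (λ _ → x∈S) , (λ _ → 0≤1) , +-identityʳ 1# ,
    λ j → trans (+-identityʳ _) (*-identityˡ (x j))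

  conv-inhabited : ∀ {d s} {S : Pred (Point d) s} {x} → x ∈ conv S → ∃[ y ] y ∈ S
  conv-inhabited (ℕ.zero , _ , _ , _ , _ , 0≈1 , _) = contradiction (sym 0≈1) 1≉0
  conv-inhabited (ℕ.suc n , _ , v , v∈S , _) = v zero , v∈S zero

  sum-identityʳ : ∀ {d} (f : Vector Carrier d) k → sum (λ j → f j * ι (identity k j)) ≈ f k
  sum-identityʳ f k = trans
    (sum-single (λ j → f j * ι (identity k j)) k (λ j j≢k →
      trans (*-congˡ (reflexive (≡.cong ι (identity-off (j≢k ∘ ≡.sym))))) (zeroʳ (f j))))
    (trans (*-congˡ (trans (reflexive (≡.cong ι (identity-diagonal k))) ι-1)) (*-identityʳ (f k)))

  sum-identityˡ : ∀ {d} (f : Vector Carrier d) k → sum (λ i → f i * ι (identity i k)) ≈ f k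
  sum-identityˡ f k = trans
    (sum-single (λ i → f i * ι (identity i k)) k (λ i i≢k →
      trans (*-congˡ (reflexive (≡.cong ι (identity-off i≢k)))) (zeroʳ (f i))))
    (trans (*-congˡ (trans (reflexive (≡.cong ι (identity-diagonal k))) ι-1)) (*-identityʳ (f k)))

  ι-identity-nonneg : ∀ {d} (k j : Fin d) → 0# ≤ ι (identity k j)
  ι-identity-nonneg k j with does (k Fin.≟ j)
  ... | true = times-nonneg 1
  ... | false = ≤-refl

  Vertex : ∀ {d} → Pred (Point d) ℓ₁
  Vertex x = (∀ i → x i ≈ 0#) ⊎ (∃[ j ] x ≋ lattice (identity j))

  vertex-nonneg : ∀ {d} {x : Point d} → Vertex x → ∀ j → 0# ≤ x j
  vertex-nonneg (inj₁ x≈0) j = ≤-reflexive (sym (x≈0 j))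
  vertex-nonneg (inj₂ (k , x≋eₖ)) j = ≤-respʳ-≈ (sym (x≋eₖ j)) (ι-identity-nonneg k j)

  vertex-sum≤1 : ∀ {d} {x : Point d} → Vertex x → sum x ≤ 1#
  vertex-sum≤1 {d} (inj₁ x≈0) = ≤-respˡ-≈ (sym (trans (sum-cong-≋ x≈0) (sum-replicate-zero d))) 0≤1
  vertex-sum≤1 (inj₂ (k , x≋eₖ)) = ≤-reflexive (trans
    (sum-cong-≋ (λ j → trans (x≋eₖ j) (sym (*-identityˡ _)))) (sum-identityʳ (λ _ → 1#) k))

  Δ⇒nonneg : ∀ {d} {x : Point d} → x ∈ Δ → ∀ j → 0# ≤ x j
  Δ⇒nonneg (n , a , v , v∈ , 0≤a , ∑a≈1 , av≈x) j =
    ≤-respʳ-≈ (av≈x j) (sum-nonneg (λ i → *-nonneg (0≤a i) (vertex-nonneg (v∈ i) j)))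

  Δ⇒sum≤1 : ∀ {d} {x : Point d} → x ∈ Δ → sum x ≤ 1#
  Δ⇒sum≤1 {x = x} (n , a , v , v∈ , 0≤a , ∑a≈1 , av≈x) = begin
    sum x                                ≈⟨ sum-cong-≋ av≈x ⟨
    sum (λ j → sum (λ i → a i * v i j))  ≈⟨ ∑-comm (λ j i → a i * v i j) ⟩
    sum (λ i → sum (λ j → a i * v i j))  ≈⟨ sum-cong-≋ (λ i → *-distribˡ-sum (a i) (v i)) ⟨
    sum (λ i → a i * sum (v i))          ≤⟨ sum-mono (λ i → *-monoʳ-≤ (0≤a i) (vertex-sum≤1 (v∈ i))) ⟩
    sum (λ i → a i * 1#)                 ≈⟨ sum-cong-≋ (λ i → *-identityʳ (a i)) ⟩
    sum a                                ≈⟨ ∑a≈1 ⟩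
    1#                                   ∎
    where open ≤-Reasoning

  -- The coordinates of `x` are its barycentric weights at the unit vectors; the origin takes the
  -- remainder `1# - sum x`.
  ⇒Δ : ∀ {d} {x : Point d} → (∀ j → 0# ≤ x j) → sum x ≤ 1# → x ∈ Δ
  ⇒Δ {d} {x} 0≤x ∑x≤1 = ℕ.suc d , (1# - sum x) ∷ x , (λ _ → 0#) ∷ (λ j → lattice (identity j)) ,
    (λ { zero → inj₁ (λ _ → refl) ; (suc j) → inj₂ (j , λ _ → refl) }) ,
    (λ { zero → ≤⇒0≤- ∑x≤1 ; (suc j) → 0≤x j }) ,
    x-y+y≈x 1# (sum x) ,
    λ j → trans (+-cong (zeroʳ _) (sum-identityˡ x j)) (+-identityˡ (x j))

  dilateΔ⇒ : ∀ {d l} {y : Point d} → 0# ≤ l → y ∈ dilate l Δ → (∀ j → 0# ≤ y j) × sum y ≤ l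
  dilateΔ⇒ {l = l} {y} 0≤l (x , x∈Δ , y≋lx) =
    (λ j → ≤-respʳ-≈ (sym (y≋lx j)) (*-nonneg 0≤l (Δ⇒nonneg x∈Δ j))) ,
    ≤-resp₂ (sym (trans (sum-cong-≋ y≋lx) (sym (*-distribˡ-sum l x)))) (*-identityʳ l) (*-monoʳ-≤ 0≤l (Δ⇒sum≤1 x∈Δ))

  -- A point of a dilate comes with a preimage in `Δ`, so `y` is divided by `ι l`; the bound `1 ≤ l`
  -- makes this possible and keeps signs.
  ⇒dilateΔ : ∀ {d l} {y : Point d} → 1ℤ ℤ.≤ l → (∀ j → 0# ≤ y j) → sum y ≤ ι l → y ∈ dilate (ι l) Δ
  ⇒dilateΔ {l = l} {y} 1≤l 0≤y ∑y≤l with ι-inverse 1≤l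
  ... | k , 0≤k , lk≈1 = (λ j → k * y j) ,
    ⇒Δ (λ j → *-nonneg 0≤k (0≤y j))
      (≤-resp₂ (*-distribˡ-sum k y) (trans (*-comm k (ι l)) lk≈1) (*-monoʳ-≤ 0≤k ∑y≤l)) ,
    λ j → sym (trans (sym (*-assoc (ι l) k (y j))) (trans (*-congʳ lk≈1) (*-identityˡ (y j))))

  -- The half-spaces of the dilated simplex, each as an upper bound for an outer normal. The normals
  -- `⊝ A r` and `columnSum A` have sum zero, like the triples of `M` and the quadruples of `merge`.
  SimplexBounds : ∀ {d} → Matrix d → Vector ℤ d → Carrier → Point d → Set ℓ₂
  SimplexBounds A t l x = (∀ r → ⟨ ⊝ A r , x ⟩ ≤ ι (t r)) × ⟨ columnSum A , x ⟩ + ι (∑ℤ t) ≤ l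

  sum-affine : ∀ {d} (A : Matrix d) t (x : Point d) → sum (affine A t x) ≈ ⟨ columnSum A , x ⟩ + ι (∑ℤ t)
  sum-affine A t x = trans (∑-distrib-+ (linear A x) (λ r → ι (t r))) (+-cong (sym (⟨⟩-columnSum A x)) (sym (ι-∑ t)))

  -x≤y⇒0≤x+y : ∀ {x y} → - x ≤ y → 0# ≤ x + y
  -x≤y⇒0≤x+y {x} {y} -x≤y = ≤-respˡ-≈ (-‿inverseʳ x) (+-monoʳ-≤ x -x≤y)

  0≤x+y⇒-x≤y : ∀ {x y} → 0# ≤ x + y → - x ≤ y
  0≤x+y⇒-x≤y {x} {y} 0≤x+y = 0≤-⇒≤ (≤-respʳ-≈ (trans (+-comm x y) (+-congˡ (sym (-‿involutive x)))) 0≤x+y)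

  ⇒SimplexBounds : ∀ {d s l} {Q : Pred (Point d) s} A t → 0# ≤ l →
    image (affine A t) Q ⊆ dilate l Δ → ∀ {x} → x ∈ Q → SimplexBounds A t l x
  ⇒SimplexBounds A t 0≤l T⊆ {x} x∈Q =
    let 0≤y , ∑y≤l = dilateΔ⇒ 0≤l (T⊆ (x , x∈Q , λ _ → refl))
    in (λ r → ≤-respˡ-≈ (sym (⟨⟩-⊝ (A r) x)) (0≤x+y⇒-x≤y (0≤y r))) , ≤-respˡ-≈ (sum-affine A t x) ∑y≤l

  SimplexBounds⇒ : ∀ {d s l} {Q : Pred (Point d) s} A t → 1ℤ ℤ.≤ l →
    (∀ {x} → x ∈ Q → SimplexBounds A t (ι l) x) → image (affine A t) Q ⊆ dilate (ι l) Δ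
  SimplexBounds⇒ A t 1≤l bounds {y} (x , x∈Q , y≋Ax+t) =
    let lower , upper = bounds x∈Q
    in ⇒dilateΔ 1≤l
      (λ r → ≤-respʳ-≈ (sym (y≋Ax+t r)) (-x≤y⇒0≤x+y (≤-respˡ-≈ (⟨⟩-⊝ (A r) x) (lower r))))
      (≤-respˡ-≈ (sym (trans (sum-cong-≋ y≋Ax+t) (sum-affine A t x))) upper)

-- Finite maxima and integral functionals.

argmax : ∀ {n q} {Q : Pred (Fin n) q} → Decidable Q → (f : Fin n → ℤ) → ∃ Q →
  ∃[ i ] Q i × (∀ j → Q j → f j ℤ.≤ f i)
argmax {ℕ.suc n} {Q = Q} Q? f (i₀ , q₀) = cases (Q? zero) (Fin.any? (Q? ∘ suc))
  where
  only : ∀ {i} → Q i → ¬ Q zero → ∃ (Q ∘ suc)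
  only {zero} q ¬q = contradiction q ¬q
  only {suc i} q _ = i , q
  compare : Q zero → ∃[ i ] Q (suc i) × (∀ j → Q (suc j) → f (suc j) ℤ.≤ f (suc i)) →
    ∃[ i ] Q i × (∀ j → Q j → f j ℤ.≤ f i)
  compare q (i , qᵢ , max) with ℤ.≤-total (f zero) (f (suc i))
  ... | inj₁ f0≤fi = suc i , qᵢ , λ { zero _ → f0≤fi ; (suc j) → max j }
  ... | inj₂ fi≤f0 = zero , q , λ { zero _ → ℤ.≤-refl ; (suc j) qⱼ → ℤ.≤-trans (max j qⱼ) fi≤f0 }
  cases : Dec (Q zero) → Dec (∃ (Q ∘ suc)) → ∃[ i ] Q i × (∀ j → Q j → f j ℤ.≤ f i)
  cases (yes q) (yes tail) = compare q (argmax (Q? ∘ suc) (f ∘ suc) tail)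
  cases (yes q) (no ¬tail) = zero , q , λ { zero _ → ℤ.≤-refl ; (suc j) qⱼ → contradiction (j , qⱼ) ¬tail }
  cases (no ¬q) _ with argmax (Q? ∘ suc) (f ∘ suc) (only q₀ ¬q)
  ... | i , qᵢ , max = suc i , qᵢ , λ { zero q → contradiction q ¬q ; (suc j) → max j }

dot-⊝ : ∀ {d} (g z : Vector ℤ d) → dot (⊝ g) z ≡ ℤ.- dot g z
dot-⊝ {ℕ.zero} g z = ≡.refl
dot-⊝ {ℕ.suc d} g z = ≡.trans
  (≡.cong₂ ℤ._+_ (≡.sym (ℤ.neg-distribˡ-* (g zero) (z zero))) (dot-⊝ (g ∘ suc) (z ∘ suc)))
  (≡.sym (ℤ.neg-distrib-+ (g zero ℤ.* z zero) (dot (g ∘ suc) (z ∘ suc))))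

dot-vec : ∀ g z → dot (vec g) z ≡ g ∙ row² z
dot-vec (a , b) z = ≡.cong (λ s → a ℤ.* z 0F ℤ.+ s) (ℤ.+-identityʳ (b ℤ.* z 1F))

dot-split : ∀ G z → dot G z ≡ G 0F ℤ.* z 0F ℤ.+ tail² G ∙ tail² z
dot-split G z = ≡.cong (λ s → G 0F ℤ.* z 0F ℤ.+ s) (dot-vec (tail² G) (λ i → z (suc i)))

dot-base : ∀ G z → z 0F ≡ 0ℤ → dot G z ≡ tail² G ∙ tail² z
dot-base G z z₀≡0 = ≡.trans (dot-split G z)
  (≡.trans (≡.cong (λ x → G 0F ℤ.* x ℤ.+ tail² G ∙ tail² z) z₀≡0)
    (≡.trans (≡.cong (ℤ._+ tail² G ∙ tail² z) (ℤ.*-zeroʳ (G 0F))) (ℤ.+-identityˡ _)))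

dot-top : ∀ G z → z 0F ≡ 1ℤ → dot G z ≡ G 0F ℤ.+ tail² G ∙ tail² z
dot-top G z z₀≡1 = ≡.trans (dot-split G z)
  (≡.trans (≡.cong (λ x → G 0F ℤ.* x ℤ.+ tail² G ∙ tail² z) z₀≡1)
    (≡.cong (ℤ._+ tail² G ∙ tail² z) (ℤ.*-identityʳ (G 0F))))

-- The unit vector of a nonzero coordinate, with its sign. Entries of size at most one keep `ε δ`
-- inside the cube given by `interior`, while the functional grows by at least `ε`.
direction : ∀ g → g ≢ 0² → Σ (Vector ℤ 2) λ δ → (∀ i → -1ℤ ℤ.≤ δ i × δ i ℤ.≤ 1ℤ) × 1ℤ ℤ.≤ dot (vec g) δ
direction (a , b) g≢0 = cases a b g≢0
  where
  unit : ∀ {z} → z ≡ -1ℤ ⊎ z ≡ 0ℤ ⊎ z ≡ 1ℤ → -1ℤ ℤ.≤ z × z ℤ.≤ 1ℤ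
  unit (inj₁ ≡.refl) = ℤ.≤-refl , -≤+
  unit (inj₂ (inj₁ ≡.refl)) = -≤+ , +≤+ ℕ.z≤n
  unit (inj₂ (inj₂ ≡.refl)) = -≤+ , ℤ.≤-refl
  e₁⁺ : ∀ a b → a ≡ a ℤ.* 1ℤ ℤ.+ (b ℤ.* 0ℤ ℤ.+ 0ℤ)
  e₁⁺ = solve-∀
  e₁⁻ : ∀ a b → ℤ.- a ≡ a ℤ.* -1ℤ ℤ.+ (b ℤ.* 0ℤ ℤ.+ 0ℤ)
  e₁⁻ = solve-∀
  e₂⁺ : ∀ a b → b ≡ a ℤ.* 0ℤ ℤ.+ (b ℤ.* 1ℤ ℤ.+ 0ℤ)
  e₂⁺ = solve-∀
  e₂⁻ : ∀ a b → ℤ.- b ≡ a ℤ.* 0ℤ ℤ.+ (b ℤ.* -1ℤ ℤ.+ 0ℤ)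
  e₂⁻ = solve-∀
  cases : ∀ a b → (a , b) ≢ 0² →
    Σ (Vector ℤ 2) λ δ → (∀ i → -1ℤ ℤ.≤ δ i × δ i ℤ.≤ 1ℤ) × 1ℤ ℤ.≤ dot (vec (a , b)) δ
  cases +[1+ n ] b _ = vec (1ℤ , 0ℤ) , (λ { 0F → unit (inj₂ (inj₂ ≡.refl)) ; 1F → unit (inj₂ (inj₁ ≡.refl)) }) ,
    ≡.subst (1ℤ ℤ.≤_) (e₁⁺ +[1+ n ] b) (+≤+ (ℕ.s≤s ℕ.z≤n))
  cases -[1+ n ] b _ = vec (-1ℤ , 0ℤ) , (λ { 0F → unit (inj₁ ≡.refl) ; 1F → unit (inj₂ (inj₁ ≡.refl)) }) ,
    ≡.subst (1ℤ ℤ.≤_) (e₁⁻ -[1+ n ] b) (+≤+ (ℕ.s≤s ℕ.z≤n))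
  cases +0 +[1+ n ] _ = vec (0ℤ , 1ℤ) , (λ { 0F → unit (inj₂ (inj₁ ≡.refl)) ; 1F → unit (inj₂ (inj₂ ≡.refl)) }) ,
    ≡.subst (1ℤ ℤ.≤_) (e₂⁺ +0 +[1+ n ]) (+≤+ (ℕ.s≤s ℕ.z≤n))
  cases +0 -[1+ n ] _ = vec (0ℤ , -1ℤ) , (λ { 0F → unit (inj₂ (inj₁ ≡.refl)) ; 1F → unit (inj₁ ≡.refl) }) ,
    ≡.subst (1ℤ ℤ.≤_) (e₂⁻ +0 -[1+ n ]) (+≤+ (ℕ.s≤s ℕ.z≤n))
  cases +0 +0 g≢0 = contradiction ≡.refl g≢0

xAxis : Vector ℤ 3
xAxis = 1ℤ ∷ 0ℤ ∷ 0ℤ ∷ []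

dot-xAxis : ∀ z → dot xAxis z ≡ z 0F
dot-xAxis z = eq (z 0F) (z 1F) (z 2F) where
  eq : ∀ x y z → 1ℤ ℤ.* x ℤ.+ (0ℤ ℤ.* y ℤ.+ (0ℤ ℤ.* z ℤ.+ 0ℤ)) ≡ x
  eq = solve-∀

xAxis-primitive : Primitive xAxis
xAxis-primitive k k∣ = ℕ.∣1⇒≡1 (k∣ 0F)

-- Widths and interior points of a lattice polytope.

module LatticePolytope {c ℓ₁ ℓ₂ p} (K : OrderedField c ℓ₁ ℓ₂) (P : Pred (Geometry.Point K 3) p)
  (n : ℕ.ℕ) (v : Vector (Vector ℤ 3) n)
  (P≐ : P ≐ Geometry.conv K (λ x → ∃[ i ] Geometry._≋_ K x (Geometry.lattice K (v i))))
  (some-vertex : Fin n) where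

  open OrderedField K hiding (zero)
  open Geometry K
  open OrderedFieldProperties K
  open ConvexProperties K

  Vertices : Pred (Point 3) ℓ₁
  Vertices x = ∃[ i ] x ≋ lattice (v i)

  vertex∈P : ∀ i → lattice (v i) ∈ P
  vertex∈P i = proj₂ P≐ (⊆conv {S = Vertices} (i , λ _ → refl))

  P-resp-≋ : ∀ {x y} → x ≋ y → x ∈ P → y ∈ P
  P-resp-≋ x≋y x∈P = proj₂ P≐ (conv-resp-≋ {S = Vertices} x≋y (proj₁ P≐ x∈P))

  P-⟨⟩≤ : ∀ G m → (∀ i → dot G (v i) ℤ.≤ m) → ∀ {x} → x ∈ P → ⟨ G , x ⟩ ≤ ι m
  P-⟨⟩≤ G m dot≤m x∈P = conv-⟨⟩≤ {S = Vertices} G (ι m)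
    (λ x (i , x≋vᵢ) → ≤-respˡ-≈ (sym (trans (⟨⟩-congʳ G x≋vᵢ) (⟨⟩-lattice G (v i)))) (ι-mono (dot≤m i)))
    (proj₁ P≐ x∈P)

  maximiser : ∀ G → ∃[ i ] ⊤ × (∀ j → ⊤ → dot G (v j) ℤ.≤ dot G (v i))
  maximiser G = argmax (λ _ → yes tt) (λ i → dot G (v i)) (some-vertex , tt)

  maximum : Vector ℤ 3 → ℤ
  maximum G = dot G (v (proj₁ (maximiser G)))

  ≤maximum : ∀ G i → dot G (v i) ℤ.≤ maximum G
  ≤maximum G i = proj₂ (proj₂ (maximiser G)) i tt

  maximum≤ : ∀ {G m} → (∀ i → dot G (v i) ℤ.≤ m) → maximum G ℤ.≤ m
  maximum≤ {G} dot≤m = dot≤m (proj₁ (maximiser G))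

  width₃ : Vector ℤ 3 → ℤ
  width₃ G = maximum G ℤ.+ maximum (⊝ G)

  isWidth : ∀ G → IsWidth P G (ι (width₃ G))
  isWidth G = ι (maximum G) , ι (ℤ.- maximum (⊝ G)) ,
    ((lattice (v i) , vertex∈P i , sym (⟨⟩-lattice G (v i))) ,
      λ r (x , x∈P , r≈) → ≤-respˡ-≈ (sym r≈) (P-⟨⟩≤ G (maximum G) (≤maximum G) x∈P)) ,
    ((lattice (v j) , vertex∈P j , trans (reflexive (≡.cong ι -max≡)) (sym (⟨⟩-lattice G (v j)))) ,
      λ r (x , x∈P , r≈) → ≤-resp₂ (sym (ι-neg (maximum (⊝ G)))) (trans (-‿involutive ⟨ G , x ⟩) (sym r≈))
        (neg-antimono-≤ (≤-respˡ-≈ (⟨⟩-⊝ G x) (P-⟨⟩≤ (⊝ G) (maximum (⊝ G)) (≤maximum (⊝ G)) x∈P)))) ,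
    trans (ι-+ (maximum G) (maximum (⊝ G)))
      (+-congˡ (sym (trans (-‿cong (ι-neg (maximum (⊝ G)))) (-‿involutive _))))
    where
    i = proj₁ (maximiser G)
    j = proj₁ (maximiser (⊝ G))
    -max≡ : ℤ.- maximum (⊝ G) ≡ dot G (v j)
    -max≡ = ≡.trans (≡.cong ℤ.-_ (dot-⊝ G (v j))) (ℤ.neg-involutive (dot G (v j)))

  widthLE : ∀ {G G′} → width₃ G ℤ.≤ width₃ G′ → WidthLE P G G′
  widthLE {G} {G′} w≤w′ = ι (width₃ G) , ι (width₃ G′) , isWidth G , isWidth G′ , ι-mono w≤w′

  interior⊆ : ∀ {d s} {Q : Pred (Point d) s} {x} → x ∈ interior Q → x ∈ Q
  interior⊆ {x = x} (ε , (0≤ε , _) , near) = near x λ i →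
    ≤-respʳ-≈ (x-y+y≈x (x i) ε) (≤-respˡ-≈ (+-identityʳ (x i - ε)) (+-monoʳ-≤ (x i - ε) 0≤ε)) ,
    ≤-respˡ-≈ (+-identityʳ (x i)) (+-monoʳ-≤ (x i) 0≤ε)

  -- A step of length `ε` along `direction` stays in `Q` and raises the functional by at least `ε`,
  -- so its value at the interior point is below `m`. At a lattice point the value is an integer,
  -- hence at most `m - 1`.
  interior-strict : ∀ {s} {Q : Pred (Point 2) s} g m → g ≢ 0² →
    (∀ {y} → y ∈ Q → ⟨ vec g , y ⟩ ≤ ι m) →
    ∀ {x} → x ∈ interiorLatticePoints Q → ⟨ vec g , x ⟩ ≤ ι (m ℤ.- 1ℤ)
  interior-strict g m g≢0 Q≤m {x} ((z , x≋z) , ε , (0≤ε , 0≉ε) , near) with direction g g≢0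
  ... | δ , δ-unit , 1≤gδ = ≤-respˡ-≈ (sym gx≈) (ι-mono gz≤m-1)
    where
    gz = dot (vec g) z
    gδ = dot (vec g) δ
    gx≈ : ⟨ vec g , x ⟩ ≈ ι gz
    gx≈ = trans (⟨⟩-congʳ (vec g) x≋z) (⟨⟩-lattice (vec g) z)
    y : Point 2
    y i = x i + ε * ι (δ i)
    y∈Q = near y λ i →
      +-monoʳ-≤ (x i) (≤-respˡ-≈ (trans (*-congˡ (-‿cong ι-1)) (trans (sym (-‿distribʳ-* ε 1#)) (-‿cong (*-identityʳ ε))))
        (*-monoʳ-≤ 0≤ε (ι-mono (proj₁ (δ-unit i))))) ,
      +-monoʳ-≤ (x i) (≤-respʳ-≈ (trans (*-congˡ ι-1) (*-identityʳ ε)) (*-monoʳ-≤ 0≤ε (ι-mono (proj₂ (δ-unit i)))))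
    gy≈ : ⟨ vec g , y ⟩ ≈ ι gz + ε * ι gδ
    gy≈ = trans (⟨⟩-+ (vec g) x (λ i → ε * ι (δ i)))
      (+-cong gx≈ (trans (⟨⟩-* (vec g) ε (lattice δ)) (*-congˡ (⟨⟩-lattice (vec g) δ))))
    gz≱m : ¬ (m ℤ.≤ gz)
    gz≱m m≤gz = 0≉ε (antisym 0≤ε (≤-trans
      (≤-respˡ-≈ (trans (*-congˡ ι-1) (*-identityʳ ε)) (*-monoʳ-≤ 0≤ε (ι-mono 1≤gδ)))
      (+-cancelʳ-≤ (ι gz) (≤-resp₂ (trans gy≈ (+-comm _ _)) (sym (+-identityˡ (ι gz)))
        (≤-trans (Q≤m y∈Q) (ι-mono m≤gz))))))
    gz≤m-1 : gz ℤ.≤ m ℤ.- 1ℤ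
    gz≤m-1 = ≡.subst (gz ℤ.≤_) (ℤ.+-comm -1ℤ m) (ℤ.i<j⇒i≤pred[j] (ℤ.≰⇒> gz≱m))

-- Polytopes of lattice width one between two lattice planes.

module WidthOne {c ℓ₁ ℓ₂ p} (K : OrderedField c ℓ₁ ℓ₂) (P : Pred (Geometry.Point K 3) p)
  (n : ℕ.ℕ) (v : Vector (Vector ℤ 3) n)
  (P≐ : P ≐ Geometry.conv K (λ x → ∃[ i ] Geometry._≋_ K x (Geometry.lattice K (v i))))
  (some-vertex : Fin n)
  (width-one : Geometry.IsLatticeWidth K P (OrderedField.1# K))
  (between : ∀ x → x ∈ P → OrderedField._≤_ K (OrderedField.0# K) (x 0F) × OrderedField._≤_ K (x 0F) (OrderedField.1# K))
  (t : Vector ℤ 2)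
  (P₁⊆interior : Geometry.image K (Geometry.translate K t) (Geometry.slice K (OrderedField.1# K) P) ⊆
    Geometry.conv K (Geometry.interiorLatticePoints K (Geometry.slice K (OrderedField.0# K) P)))
  where

  open OrderedField K hiding (zero)
  open Geometry K
  open OrderedFieldProperties K
  open ConvexProperties K
  open LatticePolytope K P n v P≐ some-vertex

  P₀ P₁ : Pred (Point 2) p
  P₀ = slice 0# P
  P₁ = slice 1# P

  τ : ℤ²
  τ = row² t

  base-or-top : ∀ i → v i 0F ≡ 0ℤ ⊎ v i 0F ≡ 1ℤ
  base-or-top i = cases (ι-cancel-≤ {0ℤ} (proj₁ (between _ (vertex∈P i))))
    (ι-cancel-≤ {j = 1ℤ} (≤-respʳ-≈ (sym ι-1) (proj₂ (between _ (vertex∈P i)))))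
    where
    cases : ∀ {x} → 0ℤ ℤ.≤ x → x ℤ.≤ 1ℤ → x ≡ 0ℤ ⊎ x ≡ 1ℤ
    cases {+ 0} _ _ = inj₁ ≡.refl
    cases {+ 1} _ _ = inj₂ ≡.refl
    cases {+ ℕ.suc (ℕ.suc _)} _ (+≤+ (ℕ.s≤s ()))

  base∈P₀ : ∀ {i} → v i 0F ≡ 0ℤ → lattice (vec (tail² (v i))) ∈ P₀
  base∈P₀ {i} x≡0 = P-resp-≋ (λ { 0F → reflexive (≡.cong ι x≡0) ; 1F → refl ; 2F → refl }) (vertex∈P i)

  top∈P₁ : ∀ {i} → v i 0F ≡ 1ℤ → lattice (vec (tail² (v i))) ∈ P₁
  top∈P₁ {i} x≡1 = P-resp-≋ (λ { 0F → trans (reflexive (≡.cong ι x≡1)) ι-1 ; 1F → refl ; 2F → refl }) (vertex∈P i)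

  maximum-xAxis : maximum xAxis ℤ.≤ 1ℤ
  maximum-xAxis = maximum≤ {xAxis} λ i → ≡.subst (ℤ._≤ 1ℤ) (≡.sym (dot-xAxis (v i)))
    ([ (λ x≡0 → ≡.subst (ℤ._≤ 1ℤ) (≡.sym x≡0) (+≤+ ℕ.z≤n)) , ℤ.≤-reflexive ]′ (base-or-top i))

  maximum-⊝xAxis : maximum (⊝ xAxis) ℤ.≤ 0ℤ
  maximum-⊝xAxis = maximum≤ {⊝ xAxis} λ i →
    ≡.subst (ℤ._≤ 0ℤ) (≡.sym (≡.trans (dot-⊝ xAxis (v i)) (≡.cong ℤ.-_ (dot-xAxis (v i)))))
    ([ (λ x≡0 → ℤ.≤-reflexive (≡.cong ℤ.-_ x≡0)) , (λ x≡1 → ≡.subst (ℤ._≤ 0ℤ) (≡.sym (≡.cong ℤ.-_ x≡1)) -≤+) ]′ (base-or-top i))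

  width₃-xAxis≤1 : width₃ xAxis ℤ.≤ 1ℤ
  width₃-xAxis≤1 = ℤ.+-mono-≤ maximum-xAxis maximum-⊝xAxis

  1≤width₃-xAxis : 1ℤ ℤ.≤ width₃ xAxis
  1≤width₃-xAxis = ι-cancel-≤ (≤-respˡ-≈ (sym ι-1) (proj₂ width-one (ι (width₃ xAxis)) (xAxis , xAxis-primitive , isWidth xAxis)))

  -- If a vertex maximising `x` had `x = 0`, the primitive vector `xAxis` would have width at most
  -- zero, below the lattice width.
  top-vertex : ∃[ i ] v i 0F ≡ 1ℤ
  top-vertex = i , [ (λ x≡0 → contradiction (ℤ.≤-trans 1≤width₃-xAxis (width≤0 x≡0)) λ { (+≤+ ()) }) , (λ x≡1 → x≡1) ]′ (base-or-top i)
    where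
    i = proj₁ (maximiser xAxis)
    width≤0 : v i 0F ≡ 0ℤ → width₃ xAxis ℤ.≤ 0ℤ
    width≤0 x≡0 = ℤ.+-mono-≤ (ℤ.≤-reflexive (≡.trans (dot-xAxis (v i)) x≡0)) maximum-⊝xAxis

  interior-point : ∃[ q ] q ∈ interiorLatticePoints P₀
  interior-point = conv-inhabited (P₁⊆interior (lattice (vec (tail² (v i))) , top∈P₁ x≡1 , λ _ → refl))
    where
    i = proj₁ top-vertex
    x≡1 = proj₂ top-vertex

  I : Set
  I = ∃[ i ] v i 0F ≡ 0ℤ

  u : I → ℤ²
  u (i , _) = tail² (v i)

  -- An interior point of `P₀` is a point of `P` with `x = 0`. If all vertices had `x = 1`, then
  -- `- x` would be at most `-1` on `P`.
  base-vertex : I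
  base-vertex with Fin.any? (λ i → v i 0F ℤ.≟ 0ℤ)
  ... | yes i = i
  ... | no ¬base = contradiction (≤-respˡ-≈ 0≈ (P-⟨⟩≤ (⊝ xAxis) -1ℤ all-top (interior⊆ {Q = P₀} (proj₂ (proj₂ interior-point))))) 0≰-1
    where
    q = proj₁ interior-point
    all-top : ∀ i → dot (⊝ xAxis) (v i) ℤ.≤ -1ℤ
    all-top i with base-or-top i
    ... | inj₁ x≡0 = contradiction (i , x≡0) ¬base
    ... | inj₂ x≡1 = ℤ.≤-reflexive (≡.trans (dot-⊝ xAxis (v i)) (≡.cong ℤ.-_ (≡.trans (dot-xAxis (v i)) x≡1)))
    0≈ : ⟨ ⊝ xAxis , 0# ∷ q ⟩ ≈ 0#
    0≈ = trans (+-cong (zeroʳ (ι -1ℤ)) (sum-zeroˡ (λ _ → 0#) q (λ _ → refl))) (+-identityˡ 0#)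
    0≰-1 : ¬ (0# ≤ ι -1ℤ)
    0≰-1 h with ι-cancel-≤ {0ℤ} { -1ℤ} h
    ... | ()

  support : ∀ g → ∃[ i ] v i 0F ≡ 0ℤ × (∀ j → v j 0F ≡ 0ℤ → g ∙ tail² (v j) ℤ.≤ g ∙ tail² (v i))
  support g = argmax (λ i → v i 0F ℤ.≟ 0ℤ) (λ i → g ∙ tail² (v i)) base-vertex

  -- The maximum is over the vertices with `x = 0` only; `P₀-⟨⟩≤` extends the bound to the whole
  -- slice, so this is the support function of `P₀`.
  H : ℤ² → ℤ
  H g = g ∙ tail² (v (proj₁ (support g)))

  H-upper : ∀ g i → g ∙ u i ℤ.≤ H g
  H-upper g (j , x≡0) = proj₂ (proj₂ (support g)) j x≡0

  H-attained : ∀ g → ∃[ i ] g ∙ u i ≡ H g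
  H-attained g = (proj₁ (support g) , proj₁ (proj₂ (support g))) , ≡.refl

  P₀-⟨⟩≤ : ∀ g {y} → y ∈ P₀ → ⟨ vec g , y ⟩ ≤ ι (H g)
  P₀-⟨⟩≤ g {y} y∈P₀ = ≤-respˡ-≈ (trans (+-congʳ (zeroʳ (ι (ℤ.- C)))) (+-identityˡ _)) (P-⟨⟩≤ G (H g) G≤ y∈P₀)
    where
    -- The penalty C on the x-coordinate makes the bound hold at the vertices with x = 1 too.
    C = maximum (0ℤ ∷ vec g) ℤ.- H g
    G : Vector ℤ 3
    G = (ℤ.- C) ∷ vec g
    eq : ∀ s m → ℤ.- (m ℤ.- s) ℤ.+ m ≡ s
    eq = solve-∀
    G≤ : ∀ i → dot G (v i) ℤ.≤ H g
    G≤ i with base-or-top i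
    ... | inj₁ x≡0 = ≡.subst (ℤ._≤ H g) (≡.sym (dot-base G (v i) x≡0)) (H-upper g (i , x≡0))
    ... | inj₂ x≡1 = begin
      dot G (v i)                                    ≡⟨ dot-top G (v i) x≡1 ⟩
      ℤ.- C ℤ.+ g ∙ tail² (v i)                      ≡⟨ ≡.cong (λ s → ℤ.- C ℤ.+ s) (ℤ.+-identityˡ (g ∙ tail² (v i))) ⟨
      ℤ.- C ℤ.+ (0ℤ ℤ.+ g ∙ tail² (v i))             ≡⟨ ≡.cong (λ s → ℤ.- C ℤ.+ s) (dot-top (0ℤ ∷ vec g) (v i) x≡1) ⟨
      ℤ.- C ℤ.+ dot (0ℤ ∷ vec g) (v i)               ≤⟨ ℤ.+-monoʳ-≤ (ℤ.- C) (≤maximum (0ℤ ∷ vec g) i) ⟩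
      ℤ.- C ℤ.+ maximum (0ℤ ∷ vec g)                 ≡⟨ eq (H g) (maximum (0ℤ ∷ vec g)) ⟩
      H g                                            ∎
      where open ℤ.≤-Reasoning

  strict : ∀ g → g ≢ 0² → ∀ {x} → x ∈ interiorLatticePoints P₀ → ⟨ vec g , x ⟩ ≤ ι (H g ℤ.- 1ℤ)
  strict g g≢0 = interior-strict {Q = P₀} g (H g) g≢0 (P₀-⟨⟩≤ g)

  -- The summand `v i 0F` is there for the last face of the simplex in space, where the column sum
  -- of `A₃` contains the row `xAxis`. The other faces and the widths use the weaker `lift≤′`.
  lift≤ : ∀ g → g ≢ 0² → ∀ i → v i 0F ℤ.+ dot (lift τ g) (v i) ℤ.≤ H g
  lift≤ g g≢0 i with base-or-top i
  ... | inj₁ x≡0 = ≡.subst (ℤ._≤ H g)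
    (≡.sym (≡.trans (≡.cong₂ ℤ._+_ x≡0 (dot-base (lift τ g) (v i) x≡0)) (ℤ.+-identityˡ _))) (H-upper g (i , x≡0))
  ... | inj₂ x≡1 = ≤-from-difference
    (≡.trans (≡.cong (λ s → H g ℤ.- s) (≡.cong₂ ℤ._+_ x≡1 (dot-top (lift τ g) (v i) x≡1))) (eq (H g) (g ∙ τ) (g ∙ w)))
    gw+gτ≤
    where
    w = tail² (v i)
    eq : ∀ h a b → h ℤ.- (1ℤ ℤ.+ (a ℤ.+ b)) ≡ (h ℤ.- 1ℤ) ℤ.- (b ℤ.+ a)
    eq = solve-∀
    gw+gτ≤ : g ∙ w ℤ.+ g ∙ τ ℤ.≤ H g ℤ.- 1ℤ
    gw+gτ≤ = ι-cancel-≤ (≤-respˡ-≈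
      (trans (⟨⟩-+ (vec g) (lattice (vec w)) (lattice t))
        (trans (+-cong (⟨⟩-lattice (vec g) (vec w)) (⟨⟩-lattice (vec g) t))
          (trans (sym (ι-+ (dot (vec g) (vec w)) (dot (vec g) t))) (reflexive (≡.cong ι (≡.cong₂ ℤ._+_ (dot-vec g (vec w)) (dot-vec g t)))))))
      (conv-⟨⟩≤ {S = interiorLatticePoints P₀} (vec g) (ι (H g ℤ.- 1ℤ)) (λ x → strict g g≢0)
        (P₁⊆interior (lattice (vec w) , top∈P₁ x≡1 , λ _ → refl))))

  open SupportFunction I u H H-upper H-attained

  -- An interior lattice point stays at least one below `H` in the directions `g` and `⊟ g`, so the
  -- width is even at least 2.
  width-positive : ∀ g → g ≢ 0² → 0ℤ ℤ.< width g
  width-positive g@(a , b) g≢0 = ℤ.suc[i]≤j⇒i<j (ℤ.≤-trans (+≤+ (ℕ.s≤s ℕ.z≤n))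
    (≤-from-difference (eq (H g) (H (⊟ g))) (≡.subst (ℤ._≤ (H g ℤ.- 1ℤ ℤ.+ (H (⊟ g) ℤ.- 1ℤ)))
      (≡.trans (≡.cong₂ ℤ._+_ (dot-vec g z) (dot-vec (⊟ g) z)) (eq′ a b (z 0F) (z 1F)))
      (ℤ.+-mono-≤ (bound g g≢0) (bound (⊟ g) (⊟-≢0 g≢0))))))
    where
    z = proj₁ (proj₁ (proj₂ interior-point))
    bound : ∀ g → g ≢ 0² → dot (vec g) z ℤ.≤ H g ℤ.- 1ℤ
    bound g g≢0 = ι-cancel-≤ (≤-respˡ-≈
      (trans (⟨⟩-congʳ (vec g) (proj₂ (proj₁ (proj₂ interior-point)))) (⟨⟩-lattice (vec g) z))
      (strict g g≢0 (proj₂ interior-point)))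
    eq : ∀ h h′ → (h ℤ.+ h′) ℤ.- + 2 ≡ (h ℤ.- 1ℤ ℤ.+ (h′ ℤ.- 1ℤ)) ℤ.- 0ℤ
    eq = solve-∀
    eq′ : ∀ a b x y → (a ℤ.* x ℤ.+ b ℤ.* y) ℤ.+ (ℤ.- a ℤ.* x ℤ.+ ℤ.- b ℤ.* y) ≡ 0ℤ
    eq′ = solve-∀

  -- Both lattice sizes from one minimal pair.

  module FromMinimal (a b : ℤ²) (a-b-minimal : Minimal a b) (a-b-reduced : Reduced a b) where

    N : ℤ
    N = M a b

    det≢0 : det a b ≢ 0ℤ
    det≢0 = ∣det∣≡1⇒det≢0 a b (proj₁ a-b-minimal)

    a≢0 : a ≢ 0²
    a≢0 = det≢0⇒≢0ˡ a b det≢0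

    b≢0 : b ≢ 0²
    b≢0 = det≢0⇒≢0ˡ b (⊟ (a ⊞ b)) (det≢0 ∘ ≡.trans (≡.sym (det-rotate a b)))

    c≢0 : ⊟ (a ⊞ b) ≢ 0²
    c≢0 = det≢0⇒≢0ˡ (⊟ (a ⊞ b)) a λ det≡0 → det≢0 (≡.trans (≡.sym (eq (proj₁ a) (proj₂ a) (proj₁ b) (proj₂ b))) det≡0)
      where
      eq : ∀ a₁ a₂ b₁ b₂ → ℤ.- (a₁ ℤ.+ b₁) ℤ.* a₂ ℤ.- ℤ.- (a₂ ℤ.+ b₂) ℤ.* a₁ ≡ a₁ ℤ.* b₂ ℤ.- a₂ ℤ.* b₁
      eq = solve-∀

    1≤N : 1ℤ ℤ.≤ N
    1≤N = ℤ.≤-trans (ℤ.i<j⇒suc[i]≤j (width-positive a a≢0)) (width≤M a b)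

    ∣det-⊟∣≡1 : ∣ det (⊟ a) (⊟ b) ∣ ≡ 1
    ∣det-⊟∣≡1 = ≡.trans (≡.cong ∣_∣ (det-⊟ a b)) (proj₁ a-b-minimal)

    A₂ : Matrix 2
    A₂ = rows (⊟ a) (⊟ b)

    A₃ : Matrix 3
    A₃ = shear τ (⊟ a) (⊟ b)

    t₂ : Vector ℤ 2
    t₂ = vec (H a , H b)

    -- `P` already starts at `x = 0`, so the additional coordinate adds nothing to the sum of the
    -- translation.
    t₃ : Vector ℤ 3
    t₃ = 0ℤ ∷ t₂

    P₀-bounds : ∀ {y} → y ∈ P₀ → SimplexBounds A₂ t₂ (ι N) y
    P₀-bounds {y} y∈P₀ =
      (λ { 0F → ≤-respˡ-≈ (⟨⟩-congˡ y (vec-⊝⊟ a)) (P₀-⟨⟩≤ a y∈P₀)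
         ; 1F → ≤-respˡ-≈ (⟨⟩-congˡ y (vec-⊝⊟ b)) (P₀-⟨⟩≤ b y∈P₀) }) ,
      ≤-resp₂ (+-congʳ (⟨⟩-congˡ y columns))
        (trans (sym (ι-+ (H (⊟ (a ⊞ b))) (∑ℤ t₂))) (reflexive (≡.cong ι (eq (H a) (H b) (H (⊟ (a ⊞ b)))))))
        (+-monoˡ-≤ (ι (∑ℤ t₂)) (P₀-⟨⟩≤ (⊟ (a ⊞ b)) y∈P₀))
      where
      vec-⊝⊟ : ∀ g i → vec g i ≡ (⊝ vec (⊟ g)) i
      vec-⊝⊟ g 0F = ≡.sym (ℤ.neg-involutive (proj₁ g))
      vec-⊝⊟ g 1F = ≡.sym (ℤ.neg-involutive (proj₂ g))
      eq₀ : ∀ x y → ℤ.- (x ℤ.+ y) ≡ ℤ.- x ℤ.+ (ℤ.- y ℤ.+ 0ℤ)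
      eq₀ = solve-∀
      columns : ∀ i → vec (⊟ (a ⊞ b)) i ≡ columnSum A₂ i
      columns 0F = eq₀ (proj₁ a) (proj₁ b)
      columns 1F = eq₀ (proj₂ a) (proj₂ b)
      eq : ∀ x y z → z ℤ.+ (x ℤ.+ (y ℤ.+ 0ℤ)) ≡ x ℤ.+ y ℤ.+ z
      eq = solve-∀

    0≤x : ∀ i → 0ℤ ℤ.≤ v i 0F
    0≤x i = [ (λ x≡0 → ℤ.≤-reflexive (≡.sym x≡0)) , (λ x≡1 → ≡.subst (0ℤ ℤ.≤_) (≡.sym x≡1) (+≤+ ℕ.z≤n)) ]′ (base-or-top i)

    lift≤′ : ∀ g → g ≢ 0² → ∀ i → dot (lift τ g) (v i) ℤ.≤ H g
    lift≤′ g g≢0 i = ℤ.≤-trans (≡.subst (ℤ._≤ v i 0F ℤ.+ dot (lift τ g) (v i)) (ℤ.+-identityˡ _)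
      (ℤ.+-monoˡ-≤ (dot (lift τ g) (v i)) (0≤x i))) (lift≤ g g≢0 i)

    dot-lift-⊟ : ∀ g z → dot (lift τ (⊟ g)) z ≡ ℤ.- dot (lift τ g) z
    dot-lift-⊟ (g₁ , g₂) z = eq g₁ g₂ (t 0F) (t 1F) (z 0F) (z 1F) (z 2F)
      where
      eq : ∀ g₁ g₂ s r x y z →
        (ℤ.- g₁ ℤ.* s ℤ.+ ℤ.- g₂ ℤ.* r) ℤ.* x ℤ.+ (ℤ.- g₁ ℤ.* y ℤ.+ (ℤ.- g₂ ℤ.* z ℤ.+ 0ℤ)) ≡
        ℤ.- ((g₁ ℤ.* s ℤ.+ g₂ ℤ.* r) ℤ.* x ℤ.+ (g₁ ℤ.* y ℤ.+ (g₂ ℤ.* z ℤ.+ 0ℤ)))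
      eq = solve-∀

    dot-⊝-lift-⊟ : ∀ g z → dot (⊝ lift τ (⊟ g)) z ≡ dot (lift τ g) z
    dot-⊝-lift-⊟ g z = ≡.trans (dot-⊝ (lift τ (⊟ g)) z)
      (≡.trans (≡.cong ℤ.-_ (dot-lift-⊟ g z)) (ℤ.neg-involutive (dot (lift τ g) z)))

    P-bounds : ∀ {x} → x ∈ P → SimplexBounds A₃ t₃ (ι N) x
    P-bounds {x} x∈P =
      (λ { 0F → P-⟨⟩≤ (⊝ xAxis) 0ℤ (λ i → ℤ.≤-trans (≤maximum (⊝ xAxis) i) maximum-⊝xAxis) x∈P
         ; 1F → P-⟨⟩≤ (⊝ lift τ (⊟ a)) (H a) (λ i → ≡.subst (ℤ._≤ H a) (≡.sym (dot-⊝-lift-⊟ a (v i))) (lift≤′ a a≢0 i)) x∈P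
         ; 2F → P-⟨⟩≤ (⊝ lift τ (⊟ b)) (H b) (λ i → ≡.subst (ℤ._≤ H b) (≡.sym (dot-⊝-lift-⊟ b (v i))) (lift≤′ b b≢0 i)) x∈P }) ,
      ≤-respʳ-≈ (trans (sym (ι-+ (H e) (∑ℤ t₃))) (reflexive (≡.cong ι (eq (H a) (H b) (H e)))))
        (+-monoˡ-≤ (ι (∑ℤ t₃)) (P-⟨⟩≤ (columnSum A₃) (H e) columns≤ x∈P))
      where
      e = ⊟ (a ⊞ b)
      eq : ∀ x y z → z ℤ.+ (0ℤ ℤ.+ (x ℤ.+ (y ℤ.+ 0ℤ))) ≡ x ℤ.+ y ℤ.+ z
      eq = solve-∀
      eq′ : ∀ a₁ a₂ b₁ b₂ s r x y z →
        x ℤ.+ ((ℤ.- (a₁ ℤ.+ b₁) ℤ.* s ℤ.+ ℤ.- (a₂ ℤ.+ b₂) ℤ.* r) ℤ.* x ℤ.+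
          (ℤ.- (a₁ ℤ.+ b₁) ℤ.* y ℤ.+ (ℤ.- (a₂ ℤ.+ b₂) ℤ.* z ℤ.+ 0ℤ))) ≡
        (1ℤ ℤ.+ ((ℤ.- a₁ ℤ.* s ℤ.+ ℤ.- a₂ ℤ.* r) ℤ.+ ((ℤ.- b₁ ℤ.* s ℤ.+ ℤ.- b₂ ℤ.* r) ℤ.+ 0ℤ))) ℤ.* x ℤ.+
        ((0ℤ ℤ.+ (ℤ.- a₁ ℤ.+ (ℤ.- b₁ ℤ.+ 0ℤ))) ℤ.* y ℤ.+ ((0ℤ ℤ.+ (ℤ.- a₂ ℤ.+ (ℤ.- b₂ ℤ.+ 0ℤ))) ℤ.* z ℤ.+ 0ℤ))
      eq′ = solve-∀
      -- `columnSum A₃` is `xAxis` plus the lift of `e`, so its value at a vertex is the left-hand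
      -- side of `lift≤`.
      columns≤ : ∀ i → dot (columnSum A₃) (v i) ℤ.≤ H e
      columns≤ i = ≡.subst (ℤ._≤ H e)
        (eq′ (proj₁ a) (proj₂ a) (proj₁ b) (proj₂ b) (t 0F) (t 1F) (v i 0F) (v i 1F) (v i 2F)) (lift≤ e c≢0 i)

    H≤shift : ∀ {g m} → (∀ i → g ∙ u i ℤ.≤ m) → H g ℤ.≤ m
    H≤shift {g} ≤m = ≤m (proj₁ (H-attained g))

    -- The bounds are read off at vertices of the base. Those on the integers `t r` descend to ℤ,
    -- whereas `l` is an arbitrary element of the field and its bound stays in `K`.
    vertex-bounds₃ : ∀ A t {l} → (∀ {x} → x ∈ P → SimplexBounds A t l x) →
      (∀ r → H (⊟ tail² (A r)) ℤ.≤ t r) × ι (H (tail² (columnSum A)) ℤ.+ ∑ℤ t) ≤ l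
    vertex-bounds₃ A t {l} bounds =
      (λ r → H≤shift {⊟ tail² (A r)} λ (i , x≡0) → ≡.subst (ℤ._≤ t r) (dot-base (⊝ A r) (v i) x≡0)
        (ι-cancel-≤ (≤-respˡ-≈ (⟨⟩-lattice (⊝ A r) (v i)) (proj₁ (bounds (vertex∈P i)) r)))) ,
      ≤-respˡ-≈ (trans (+-congʳ (trans (⟨⟩-lattice s (v k)) (reflexive (≡.cong ι (dot-base s (v k) x≡0)))))
        (sym (ι-+ (H (tail² s)) (∑ℤ t)))) (proj₂ (bounds (vertex∈P k)))
      where
      s = columnSum A
      k = proj₁ (support (tail² s))
      x≡0 = proj₁ (proj₂ (support (tail² s)))

    -- On the base the four outer normals become `⊟ g r` and `s`, of sum zero, and `merge` compares
    -- them with the minimal triple. Asking only for `Nondegenerate` lets this serve both invertible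
    -- maps and the products `D · A₃`.
    lower₃ : ∀ A t {l} → Nondegenerate A → (∀ {x} → x ∈ P → SimplexBounds A t l x) → ι N ≤ l
    lower₃ A t {l} nondegenerate bounds = ≤-trans (ι-mono N≤) (proj₂ vb)
      where
      vb = vertex-bounds₃ A t bounds
      g : Fin 3 → ℤ²
      g r = tail² (A r)
      s = tail² (columnSum A)
      det-⊟≢0 : ∀ i j → det (g i) (g j) ≢ 0ℤ → det (⊟ g i) (⊟ g j) ≢ 0ℤ
      det-⊟≢0 i j ≢0 ≡0 = ≢0 (≡.trans (≡.sym (det-⊟ (g i) (g j))) ≡0)
      minors : det (⊟ g 0F) (⊟ g 1F) ≢ 0ℤ ⊎ det (⊟ g 1F) (⊟ g 2F) ≢ 0ℤ ⊎ det (⊟ g 2F) (⊟ g 0F) ≢ 0ℤ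
      minors = Sum.map (det-⊟≢0 0F 1F) (Sum.map (det-⊟≢0 1F 2F) (det-⊟≢0 2F 0F)) nondegenerate
      eq₀ : ∀ x y z → ℤ.- (ℤ.- x ℤ.+ ℤ.- y ℤ.+ ℤ.- z) ≡ x ℤ.+ (y ℤ.+ (z ℤ.+ 0ℤ))
      eq₀ = solve-∀
      sum≡s : ⊟ (⊟ g 0F ⊞ ⊟ g 1F ⊞ ⊟ g 2F) ≡ s
      sum≡s = ≡.cong₂ _,_ (eq₀ (A 0F 1F) (A 1F 1F) (A 2F 1F)) (eq₀ (A 0F 2F) (A 1F 2F) (A 2F 2F))
      eq : ∀ x y z w → w ℤ.+ (x ℤ.+ (y ℤ.+ (z ℤ.+ 0ℤ))) ≡ x ℤ.+ y ℤ.+ z ℤ.+ w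
      eq = solve-∀
      N≤ : N ℤ.≤ H s ℤ.+ ∑ℤ t
      N≤ = begin
        N                                                                 ≤⟨ merge {a} {b} a-b-minimal (⊟ g 0F) (⊟ g 1F) (⊟ g 2F) minors ⟩
        H (⊟ g 0F) ℤ.+ H (⊟ g 1F) ℤ.+ H (⊟ g 2F) ℤ.+ H (⊟ (⊟ g 0F ⊞ ⊟ g 1F ⊞ ⊟ g 2F))
          ≡⟨ ≡.cong (λ h → H (⊟ g 0F) ℤ.+ H (⊟ g 1F) ℤ.+ H (⊟ g 2F) ℤ.+ H h) sum≡s ⟩
        H (⊟ g 0F) ℤ.+ H (⊟ g 1F) ℤ.+ H (⊟ g 2F) ℤ.+ H s
          ≤⟨ ℤ.+-monoˡ-≤ (H s) (ℤ.+-mono-≤ (ℤ.+-mono-≤ (proj₁ vb 0F) (proj₁ vb 1F)) (proj₁ vb 2F)) ⟩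
        t 0F ℤ.+ t 1F ℤ.+ t 2F ℤ.+ H s                                    ≡⟨ eq (t 0F) (t 1F) (t 2F) (H s) ⟨
        H s ℤ.+ ∑ℤ t                                                      ∎
        where open ℤ.≤-Reasoning

    lower₂ : ∀ A t {l} → det (row² (A 0F)) (row² (A 1F)) ≢ 0ℤ → (∀ {y} → y ∈ P₀ → SimplexBounds A t l y) → ι N ≤ l
    lower₂ A t {l} det≢0 bounds = ≤-trans (ι-mono N≤) top≤
      where
      g₀ = row² (A 0F)
      g₁ = row² (A 1F)
      s = columnSum A
      w : Fin n → Vector ℤ 2
      w i = vec (tail² (v i))
      dot-w : ∀ (g : Vector ℤ 2) i → dot g (w i) ≡ row² g ∙ tail² (v i)
      dot-w g i = dot-vec (row² g) (w i)
      side : ∀ r → H (⊟ row² (A r)) ℤ.≤ t r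
      side r = H≤shift {⊟ row² (A r)} λ (i , x≡0) → ≡.subst (ℤ._≤ t r) (dot-w (⊝ A r) i)
        (ι-cancel-≤ (≤-respˡ-≈ (⟨⟩-lattice (⊝ A r) (w i)) (proj₁ (bounds (base∈P₀ x≡0)) r)))
      k = proj₁ (support (row² s))
      top≤ : ι (H (row² s) ℤ.+ ∑ℤ t) ≤ l
      top≤ = ≤-respˡ-≈ (trans (+-congʳ (trans (⟨⟩-lattice s (w k)) (reflexive (≡.cong ι (dot-w s k)))))
        (sym (ι-+ (H (row² s)) (∑ℤ t)))) (proj₂ (bounds (base∈P₀ (proj₁ (proj₂ (support (row² s)))))))
      eq₀ : ∀ x y → ℤ.- (ℤ.- x ℤ.+ ℤ.- y) ≡ x ℤ.+ (y ℤ.+ 0ℤ)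
      eq₀ = solve-∀
      sum≡s : ⊟ (⊟ g₀ ⊞ ⊟ g₁) ≡ row² s
      sum≡s = ≡.cong₂ _,_ (eq₀ (A 0F 0F) (A 1F 0F)) (eq₀ (A 0F 1F) (A 1F 1F))
      eq : ∀ x y w → w ℤ.+ (x ℤ.+ (y ℤ.+ 0ℤ)) ≡ x ℤ.+ y ℤ.+ w
      eq = solve-∀
      N≤ : N ℤ.≤ H (row² s) ℤ.+ ∑ℤ t
      N≤ = begin
        N                                         ≤⟨ proj₂ a-b-minimal (⊟ g₀) (⊟ g₁) (det≢0 ∘ ≡.trans (≡.sym (det-⊟ g₀ g₁))) ⟩
        H (⊟ g₀) ℤ.+ H (⊟ g₁) ℤ.+ H (⊟ (⊟ g₀ ⊞ ⊟ g₁)) ≡⟨ ≡.cong (λ h → H (⊟ g₀) ℤ.+ H (⊟ g₁) ℤ.+ H h) sum≡s ⟩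
        H (⊟ g₀) ℤ.+ H (⊟ g₁) ℤ.+ H (row² s)      ≤⟨ ℤ.+-monoˡ-≤ (H (row² s)) (ℤ.+-mono-≤ (side 0F) (side 1F)) ⟩
        t 0F ℤ.+ t 1F ℤ.+ H (row² s)              ≡⟨ eq (t 0F) (t 1F) (H (row² s)) ⟨
        H (row² s) ℤ.+ ∑ℤ t                       ∎
        where open ℤ.≤-Reasoning

    0≤ιN : 0# ≤ ι N
    0≤ιN = ι-nonneg (ℤ.≤-trans (+≤+ ℕ.z≤n) 1≤N)

    latticeSize-P : IsLatticeSize P (ι N)
    latticeSize-P =
      (0≤ιN , A₃ , t₃ , shear-invertible τ (⊟ a) (⊟ b) ∣det-⊟∣≡1 , SimplexBounds⇒ {Q = P} A₃ t₃ 1≤N P-bounds) ,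
      λ l (0≤l , A , s , invertible , T⊆) →
        lower₃ A s (invertible⇒nondegenerate {A} invertible) (⇒SimplexBounds {Q = P} A s 0≤l T⊆)

    latticeSize-P₀ : IsLatticeSize P₀ (ι N)
    latticeSize-P₀ =
      (0≤ιN , A₂ , t₂ , rows-invertible (⊟ a) (⊟ b) ∣det-⊟∣≡1 , SimplexBounds⇒ {Q = P₀} A₂ t₂ 1≤N P₀-bounds) ,
      λ l (0≤l , A , s , invertible , T⊆) →
        lower₂ A s (invertible⇒det≢0 {A} invertible) (⇒SimplexBounds {Q = P₀} A s 0≤l T⊆)

    -- Multiplication by a diagonal sign matrix only changes the signs of the minors of A₃.
    sign-nondegenerate : ∀ {D} → SignDiagonal D → Nondegenerate (D · A₃)
    sign-nondegenerate {D} (σ , D≡) = inj₂ (inj₁ λ det≡0 → contradiction (≡.trans (≡.sym ∣det∣≡1) (≡.cong ∣_∣ det≡0)) λ ())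
      where
      sgn : Fin 3 → ℤ
      sgn i = σ i ℤ.◃ 1
      entry : ∀ i j → (D · A₃) i j ≡ sgn i ℤ.* A₃ i j
      entry i j = ≡.trans (∑ℤ-cong (λ k → ≡.cong (ℤ._* A₃ k j) (D≡ i k))) (diagonal-· sgn A₃ i j)
      eq : ∀ s r a₁ a₂ b₁ b₂ → s ℤ.* a₁ ℤ.* (r ℤ.* b₂) ℤ.- s ℤ.* a₂ ℤ.* (r ℤ.* b₁) ≡ s ℤ.* (r ℤ.* (a₁ ℤ.* b₂ ℤ.- a₂ ℤ.* b₁))
      eq = solve-∀
      det≡ : det (tail² ((D · A₃) 1F)) (tail² ((D · A₃) 2F)) ≡ sgn 1F ℤ.* (sgn 2F ℤ.* det (⊟ a) (⊟ b))
      det≡ = ≡.trans (≡.cong₂ ℤ._-_ (≡.cong₂ ℤ._*_ (entry 1F 1F) (entry 2F 2F)) (≡.cong₂ ℤ._*_ (entry 1F 2F) (entry 2F 1F)))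
        (eq (sgn 1F) (sgn 2F) (ℤ.- proj₁ a) (ℤ.- proj₂ a) (ℤ.- proj₁ b) (ℤ.- proj₂ b))
      ∣sgn*∣ : ∀ i z → ∣ z ∣ ≡ 1 → ∣ sgn i ℤ.* z ∣ ≡ 1
      ∣sgn*∣ i z ∣z∣≡1 = ≡.trans (ℤ.abs-* (sgn i) z) (≡.cong₂ ℕ._*_ (ℤ.abs-◃ (σ i) 1) ∣z∣≡1)
      ∣det∣≡1 : ∣ det (tail² ((D · A₃) 1F)) (tail² ((D · A₃) 2F)) ∣ ≡ 1
      ∣det∣≡1 = ≡.trans (≡.cong ∣_∣ det≡) (∣sgn*∣ 1F (sgn 2F ℤ.* det (⊟ a) (⊟ b)) (∣sgn*∣ 2F (det (⊟ a) (⊟ b)) ∣det-⊟∣≡1))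

    -- `A₃` already puts `P` in position, so the identity with `t₃` attains the value. A sign matrix
    -- `D` acting on the image of `P` is `D · A₃` acting on `P`, to which `lower₃` applies.
    naiveLatticeSize : IsNaiveLatticeSize (image (linear A₃) P) (ι N)
    naiveLatticeSize =
      (0≤ιN , identity , t₃ , ((λ _ → Sign.+) , λ _ _ → ≡.refl) ,
        λ {y} (x′ , (x , x∈P , x′≋) , y≋) → SimplexBounds⇒ {Q = P} A₃ t₃ 1≤N P-bounds
          (x , x∈P , λ r → trans (y≋ r) (+-congʳ (trans (⟨identity,⟩ r x′) (x′≋ r))))) ,
      λ l (0≤l , D , s , sign , T⊆) → lower₃ (D · A₃) s (sign-nondegenerate sign)
        (⇒SimplexBounds {Q = P} (D · A₃) s 0≤l λ {y} (x , x∈P , y≋) → T⊆ (linear A₃ x , (x , x∈P , λ _ → refl) ,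
          λ r → trans (y≋ r) (+-congʳ (⟨⟩-combination (D r) A₃ x))))
      where
      ⟨identity,⟩ : ∀ r (x : Point 3) → ⟨ identity r , x ⟩ ≈ x r
      ⟨identity,⟩ r x = trans (sum-cong-≋ (λ j → *-comm (ι (identity r j)) (x j))) (sum-identityʳ x r)

    -- Reducedness of the lifted basis.

    H≤maximum : ∀ G → H (tail² G) ℤ.≤ maximum G
    H≤maximum G = H≤shift {tail² G} λ (i , x≡0) → ≡.subst (ℤ._≤ maximum G) (dot-base G (v i) x≡0) (≤maximum G i)

    -- On the base a functional sees only its tail. So no multiple of `xAxis` brings a width below
    -- that on `P₀`, which settles the coefficient `m` in the third condition of reducedness.
    width≤width₃ : ∀ G → width (tail² G) ℤ.≤ width₃ G
    width≤width₃ G = ℤ.+-mono-≤ (H≤maximum G) (H≤maximum (⊝ G))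

    -- The shear keeps the top below `H` in both directions, so the lift gains no width over `P₀`.
    width₃-lift≤ : ∀ g → g ≢ 0² → width₃ (lift τ (⊟ g)) ℤ.≤ width g
    width₃-lift≤ g g≢0 = ℤ.≤-trans
      (ℤ.+-mono-≤
        (maximum≤ {lift τ (⊟ g)} (lift≤′ (⊟ g) (⊟-≢0 g≢0)))
        (maximum≤ {⊝ lift τ (⊟ g)} λ i → ≡.subst (ℤ._≤ H g) (≡.sym (dot-⊝-lift-⊟ g (v i))) (lift≤′ g g≢0 i)))
      (ℤ.≤-reflexive (ℤ.+-comm (H (⊟ g)) (H g)))

    ≤width₃ : ∀ {w} G {g} → tail² G ≡ g → w ℤ.≤ width g → w ℤ.≤ width₃ G
    ≤width₃ G ≡.refl w≤ = ℤ.≤-trans w≤ (width≤width₃ G)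

    width-lift : ∀ g → width g ℤ.≤ width₃ (lift τ (⊟ g))
    width-lift g = ≤width₃ (lift τ (⊟ g)) ≡.refl (ℤ.≤-reflexive (≡.sym (width-⊟ g)))

    isReduced : IsReduced P A₃
    isReduced = record
      { basis = invertible⇒basis {h = A₃} (shear-invertible τ (⊟ a) (⊟ b) ∣det-⊟∣≡1)
      ; h₁≤h₂ = widthLE {xAxis} {l₂} (ℤ.≤-trans width₃-xAxis≤1
          (ℤ.≤-trans (ℤ.i<j⇒suc[i]≤j (width-positive a a≢0)) (width-lift a)))
      ; h₂≤h₃ = widthLE {l₂} {l₃} (ℤ.≤-trans (width₃-lift≤ a a≢0) (ℤ.≤-trans (proj₁ a-b-reduced) (width-lift b)))
      ; h₂≤h₁+h₂ = widthLE {l₂} {xAxis ⊕ l₂} (ℤ.≤-trans (width₃-lift≤ a a≢0) (≤width₃ (xAxis ⊕ l₂)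
          (≡.cong₂ _,_ (ℤ.+-identityˡ (ℤ.- proj₁ a)) (ℤ.+-identityˡ (ℤ.- proj₂ a))) (ℤ.≤-reflexive (≡.sym (width-⊟ a)))))
      ; h₂≤h₁-h₂ = widthLE {l₂} {xAxis ⊖ l₂} (ℤ.≤-trans (width₃-lift≤ a a≢0) (≤width₃ (xAxis ⊖ l₂)
          (≡.cong₂ _,_ (eq₀ (proj₁ a)) (eq₀ (proj₂ a))) ℤ.≤-refl))
      ; h₃-least = λ m k → widthLE {l₃} {m ⊙ xAxis ⊕ k ⊙ l₂ ⊕ l₃} (ℤ.≤-trans (width₃-lift≤ b b≢0) (≤width₃ (m ⊙ xAxis ⊕ k ⊙ l₂ ⊕ l₃)
          (≡.cong₂ _,_ (eq m k (proj₁ a) (proj₁ b)) (eq m k (proj₂ a) (proj₂ b)))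
          (ℤ.≤-trans (reduced {a} {b} a-b-minimal a-b-reduced k) (ℤ.≤-reflexive (≡.sym (width-⊟ (k ⊡ a ⊞ b)))))))
      }
      where
      l₂ = lift τ (⊟ a)
      l₃ = lift τ (⊟ b)
      eq₀ : ∀ x → 0ℤ ℤ.- ℤ.- x ≡ x
      eq₀ = solve-∀
      eq : ∀ m k x y → m ℤ.* 0ℤ ℤ.+ k ℤ.* ℤ.- x ℤ.+ ℤ.- y ≡ ℤ.- (k ℤ.* x ℤ.+ y)
      eq = solve-∀

  Conclusion : Set (c ⊔ ℓ₁ ⊔ ℓ₂ ⊔ p)
  Conclusion = (∃[ l ] IsLatticeSize P l × IsLatticeSize P₀ l) × (Σ (Matrix 3) λ h → IsReduced P h × ComputesLatticeSize P h)

  conclude : (∃[ a ] ∃[ b ] Minimal a b × Reduced a b) → Conclusion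
  conclude (a , b , a-b-minimal , a-b-reduced) =
    (ι N , latticeSize-P , latticeSize-P₀) , A₃ , isReduced , ι N , latticeSize-P , naiveLatticeSize
    where open FromMinimal a b a-b-minimal a-b-reduced

  conclusion : Conclusion
  conclusion = conclude (Minimisation.minimal width-positive)

theorem5p3 : ∀ {c ℓ₁ ℓ₂ p : Level} (K : OrderedField c ℓ₁ ℓ₂) →
    let open OrderedField K
        open Geometry K
    in (P : Pred (Point 3) p) →
       IsLatticePolytope P →
       IsLatticeWidth P 1# →
       (∀ x → x ∈ P → 0# ≤ x 0F × x 0F ≤ 1#) →
       let P₀ = slice 0# P
           P₁ = slice 1# P
       in (Σ (Vector ℤ 2) λ t →
            image (translate t) P₁ ⊆ conv (interiorLatticePoints P₀)) →
          (∃[ l ] IsLatticeSize P l × IsLatticeSize P₀ l) ×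
          (Σ (Matrix 3) λ h → IsReduced P h × ComputesLatticeSize P h)
-- A lattice polytope may come with an empty list of vertices. The point of `P` at which the
-- functional realising the lattice width is maximal excludes this and supplies a vertex.
theorem5p3 K P (n , v , P≐) width-one@((_ , _ , _ , _ , ((x , x∈P , _) , _) , _) , _) between (t , P₁⊆interior) =
  WidthOne.conclusion K P n v P≐
    (proj₁ (proj₂ (ConvexProperties.conv-inhabited K {S = Vertices} (proj₁ P≐ x∈P))))
    width-one between t P₁⊆interior
  where
  Vertices : Pred (Geometry.Point K 3) _
  Vertices y = ∃[ i ] Geometry._≋_ K y (Geometry.lattice K (v i))
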